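{- For every $\lambda<1$ and every odd positive integer $D$, there exists $\lambda'<1$ (depending only on $\lambda$ and $D$) such that for every $N$, if $G$ is an $(N,D,\lambda)$-graph and $C$ is the cycle on $D$ vertices, then the zig-zag product of $G$ (as the large graph) with $C$ (as the small graph) is an $(ND,4,\lambda')$-graph.
   Context: For a positive integer $n$, $[n]=\{1,\dots,n\}$. Graphs are finite, undirected and regular, and may have self-loops and parallel edges. A $D$-regular graph $G$ on $[N]$ is specified by its rotation map $\mathrm{Rot}_G:[N]\times[D]\to[N]\times[D]$: $\mathrm{Rot}_G(v,i)=(w,j)$ means that the $i$-th edge incident to $v$ leads to $w$ and that this edge is the $j$-th edge incident to $w$. Thus $\mathrm{Rot}_G$ is a permutation with $\mathrm{Rot}_G\circ\mathrm{Rot}_G=\mathrm{id}$ (and any such involution specifies a $D$-regular graph). Vertex sets and sets of edge labels may be any finite sets of the right cardinality. The cycle $C$ is the 2-regular graph on $[D]$ in which $i$ is joined to $i\pm1$ modulo $D$ (with any edge labeling). The normalized adjacency matrix of $G$ is the symmetric $N\times N$ matrix with $M_{u,v}=\frac1D|\{(i,j)\in[D]^2:\mathrm{Rot}_G(u,i)=(v,j)\}|$. The second largest eigenvalue in absolute value is $\lambda(G)=\max_{\alpha\perp 1_N,\,\alpha\ne0}\|M\alpha\|/\|\alpha\|$, where $1_N$ is the all-ones vector and the norm is Euclidean (with $\lambda(G)=0$ if $N=1$). An $(N,D,\lambda)$-graph is a $D$-regular graph on $N$ vertices with $\lambda(G)\le\lambda$. Zig-zag product: for a $D_1$-regular graph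 $G_1$ on $[N_1]$ (the large graph) and a $D_2$-regular graph $G_2$ on $[D_1]$ (the small graph), it is the $D_2^2$-regular graph on $[N_1]\times[D_1]$, with edge labels in $[D_2]\times[D_2]$, whose rotation map sends $((v,k),(i,j))$ to $((w,\ell),(j',i'))$, where $(k',i')=\mathrm{Rot}_{G_2}(k,i)$, then $(w,\ell')=\mathrm{Rot}_{G_1}(v,k')$, then $(\ell,j')=\mathrm{Rot}_{G_2}(\ell',j)$. -}

module Defs where

open import Data.Nat as ℕ using (ℕ; zero; suc; NonZero)
import Data.Nat.Properties as ℕ
import Data.Nat.DivMod as ℕ
import Data.Integer as ℤ
import Data.Integer.Properties as ℤ
import Data.Integer.Solver as ℤ
open import Data.Rational as ℚ
  using (ℚ; mkℚ; 0ℚ; 1ℚ; ½; _+_; _*_; _-_; -_; _≤_; _<_; 1/_; ∣_∣; *≤*; *<*)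
open import Data.Rational.Properties as ℚ
import Data.Rational.Unnormalised as ℚᵘ
import Data.Rational.Unnormalised.Properties as ℚᵘ
open import Data.Rational.Solver using (module +-*-Solver)
open import Data.Fin as Fin using (Fin; toℕ; combine; remQuot)
import Data.Fin.Properties as Fin
open import Data.Bool using (if_then_else_)
open import Data.Product using (∃; _×_; _,_; proj₁; proj₂)
import Data.Product.Properties as Product
open import Data.Sum using (_⊎_; inj₁; inj₂)
open import Data.Vec.Functional using (Vector; foldr)
open import Relation.Nullary using (¬_; yes; no; does; contradiction)
open import Relation.Binary.Definitions using (DecidableEquality)
open import Relation.Binary.PropositionalEquality

------------------------------------------------------------------------
-- Facts about ℚ

half+half : ∀ p → ½ * p + ½ * p ≡ p
half+half = solve 1 (λ p → con ½ :* p :+ con ½ :* p := p) refl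
  where open +-*-Solver

half>0 : ∀ {p} → 0ℚ < p → 0ℚ < ½ * p
half>0 {p} 0<p = positive⁻¹ (½ * p) {{pos*pos⇒pos ½ p {{ℚ.positive 0<p}}}}

*-mono-≤-nonNeg : ∀ {p q r s} → 0ℚ ≤ r → 0ℚ ≤ q → p ≤ q → r ≤ s → p * r ≤ q * s
*-mono-≤-nonNeg {p} {q} {r} {s} 0≤r 0≤q p≤q r≤s =
  ≤-trans (*-monoʳ-≤-nonNeg r {{ℚ.nonNegative 0≤r}} p≤q)
          (*-monoˡ-≤-nonNeg q {{ℚ.nonNegative 0≤q}} r≤s)

p≤∣p∣ : ∀ p → p ≤ ∣ p ∣
p≤∣p∣ p with ≤-total 0ℚ p
... | inj₁ 0≤p = ≤-reflexive (sym (0≤p⇒∣p∣≡p 0≤p))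
... | inj₂ p≤0 = ≤-trans p≤0 (0≤∣p∣ p)

p≤q+r⇒p-q≤r : ∀ {p q r} → p ≤ q + r → p - q ≤ r
p≤q+r⇒p-q≤r {p} {q} {r} h =
  ≤-trans (+-monoˡ-≤ (- q) h) (≤-reflexive (lemma q r))
  where
  open +-*-Solver
  lemma : ∀ q r → (q + r) - q ≡ r
  lemma = solve 2 (λ q r → (q :+ r) :- q := r) refl

∣p-q∣≤r : ∀ {p q r} → p ≤ q + r → q ≤ p + r → ∣ p - q ∣ ≤ r
∣p-q∣≤r {p} {q} {r} h k with ∣p∣≡p∨∣p∣≡-p (p - q)
... | inj₁ e = ≤-trans (≤-reflexive e) (p≤q+r⇒p-q≤r h)
... | inj₂ e = ≤-trans (≤-reflexive (trans e (lemma p q))) (p≤q+r⇒p-q≤r k)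
  where
  open +-*-Solver
  lemma : ∀ p q → - (p - q) ≡ q - p
  lemma = solve 2 (λ p q → :- (p :- q) := q :- p) refl

∣p∣≤∣q∣+∣p-q∣ : ∀ p q → ∣ p ∣ ≤ ∣ q ∣ + ∣ p - q ∣
∣p∣≤∣q∣+∣p-q∣ p q =
  ≤-trans (≤-reflexive (cong ∣_∣ (lemma p q))) (∣p+q∣≤∣p∣+∣q∣ q (p - q))
  where
  open +-*-Solver
  lemma : ∀ p q → p ≡ q + (p - q)
  lemma = solve 2 (λ p q → p := q :+ (p :- q)) refl

rescale : ∀ B ε → 0ℚ < B → 0ℚ < ε → ∃ λ δ → 0ℚ < δ × B * δ ≡ ε
rescale B ε 0<B 0<ε = 1/B * ε , 0<δ , eq
  where
  instance
    posB = ℚ.positive 0<B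
    posε = ℚ.positive 0<ε
    nzB  = pos⇒nonZero B
  1/B : ℚ
  1/B = 1/ B
  0<δ : 0ℚ < 1/B * ε
  0<δ = positive⁻¹ (1/B * ε) {{pos*pos⇒pos 1/B {{1/pos⇒pos B}} ε}}
  eq : B * (1/B * ε) ≡ ε
  eq = trans (sym (*-assoc B 1/B ε))
             (trans (cong (_* ε) (*-inverseʳ B)) (*-identityˡ ε))

------------------------------------------------------------------------
-- Real numbers, as Cauchy sequences of rationals.  As usual for this
-- construction, equality of reals is the relation _≃_ below.

record ℝ : Set where
  constructor mkℝ
  field
    seq    : ℕ → ℚ
    cauchy : ∀ ε → 0ℚ < ε → ∃ λ K → ∀ m n → K ℕ.≤ m → K ℕ.≤ n → ∣ seq m - seq n ∣ ≤ ε

open ℝ public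

infix 4 _≃_ _≤ᴿ_ _<ᴿ_

_≃_ : ℝ → ℝ → Set
x ≃ y = ∀ ε → 0ℚ < ε → ∃ λ K → ∀ n → K ℕ.≤ n → ∣ seq x n - seq y n ∣ ≤ ε

_≤ᴿ_ : ℝ → ℝ → Set
x ≤ᴿ y = ∀ ε → 0ℚ < ε → ∃ λ K → ∀ n → K ℕ.≤ n → seq x n ≤ seq y n + ε

_<ᴿ_ : ℝ → ℝ → Set
x <ᴿ y = ∃ λ ε → 0ℚ < ε × (∃ λ K → ∀ n → K ℕ.≤ n → seq x n + ε ≤ seq y n)

fromℚ : ℚ → ℝ
fromℚ p = mkℝ (λ _ → p) λ ε 0<ε → 0 , λ _ _ _ _ →
  ≤-trans (≤-reflexive (cong ∣_∣ (+-inverseʳ p))) (<⇒≤ 0<ε)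

0ᴿ 1ᴿ : ℝ
0ᴿ = fromℚ 0ℚ
1ᴿ = fromℚ 1ℚ

infixl 6 _+ᴿ_
infixl 7 _*ᴿ_

_+ᴿ_ : ℝ → ℝ → ℝ
x +ᴿ y = mkℝ (λ n → seq x n + seq y n) c
  where
  open +-*-Solver
  lemma : ∀ a b c d → (a + b) - (c + d) ≡ (a - c) + (b - d)
  lemma = solve 4 (λ a b c d → (a :+ b) :- (c :+ d) := (a :- c) :+ (b :- d)) refl
  c : ∀ ε → 0ℚ < ε → ∃ λ K → ∀ m n → K ℕ.≤ m → K ℕ.≤ n →
      ∣ (seq x m + seq y m) - (seq x n + seq y n) ∣ ≤ ε
  c ε 0<ε with cauchy x (½ * ε) (half>0 0<ε) | cauchy y (½ * ε) (half>0 0<ε)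
  ... | K₁ , h₁ | K₂ , h₂ = K₁ ℕ.⊔ K₂ , λ m n K≤m K≤n → begin
    ∣ (seq x m + seq y m) - (seq x n + seq y n) ∣
      ≡⟨ cong ∣_∣ (lemma (seq x m) (seq y m) (seq x n) (seq y n)) ⟩
    ∣ (seq x m - seq x n) + (seq y m - seq y n) ∣
      ≤⟨ ∣p+q∣≤∣p∣+∣q∣ (seq x m - seq x n) (seq y m - seq y n) ⟩
    ∣ seq x m - seq x n ∣ + ∣ seq y m - seq y n ∣
      ≤⟨ +-mono-≤ (h₁ m n (ℕ.m⊔n≤o⇒m≤o K₁ K₂ K≤m) (ℕ.m⊔n≤o⇒m≤o K₁ K₂ K≤n))
                  (h₂ m n (ℕ.m⊔n≤o⇒n≤o K₁ K₂ K≤m) (ℕ.m⊔n≤o⇒n≤o K₁ K₂ K≤n)) ⟩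
    ½ * ε + ½ * ε
      ≡⟨ half+half ε ⟩
    ε ∎
    where open ≤-Reasoning

bounded : ∀ x → ∃ λ B → 0ℚ < B × (∃ λ K → ∀ n → K ℕ.≤ n → ∣ seq x n ∣ ≤ B)
bounded x with cauchy x 1ℚ (positive⁻¹ 1ℚ)
... | K , h = ∣ seq x K ∣ + 1ℚ , 0<B , K , λ n K≤n →
  ≤-trans (∣p∣≤∣q∣+∣p-q∣ (seq x n) (seq x K)) (+-monoʳ-≤ ∣ seq x K ∣ (h n K K≤n ℕ.≤-refl))
  where
  0<B : 0ℚ < ∣ seq x K ∣ + 1ℚ
  0<B = +-mono-≤-< (0≤∣p∣ (seq x K)) (positive⁻¹ 1ℚ)

*-close : ∀ {A B a b c d δ η} → 0ℚ ≤ A → 0ℚ ≤ B → ∣ a ∣ ≤ A → ∣ d ∣ ≤ B →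
          ∣ b - d ∣ ≤ δ → ∣ a - c ∣ ≤ η → ∣ a * b - c * d ∣ ≤ A * δ + B * η
*-close {A} {B} {a} {b} {c} {d} {δ} {η} 0≤A 0≤B ha hd hbd hac = begin
  ∣ a * b - c * d ∣
    ≡⟨ cong ∣_∣ (lemma a b c d) ⟩
  ∣ a * (b - d) + d * (a - c) ∣
    ≤⟨ ∣p+q∣≤∣p∣+∣q∣ (a * (b - d)) (d * (a - c)) ⟩
  ∣ a * (b - d) ∣ + ∣ d * (a - c) ∣
    ≡⟨ cong₂ _+_ (∣p*q∣≡∣p∣*∣q∣ a (b - d)) (∣p*q∣≡∣p∣*∣q∣ d (a - c)) ⟩
  ∣ a ∣ * ∣ b - d ∣ + ∣ d ∣ * ∣ a - c ∣
    ≤⟨ +-mono-≤ (*-mono-≤-nonNeg (0≤∣p∣ (b - d)) 0≤A ha hbd)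
                (*-mono-≤-nonNeg (0≤∣p∣ (a - c)) 0≤B hd hac) ⟩
  A * δ + B * η ∎
  where
  open ≤-Reasoning
  open +-*-Solver
  lemma : ∀ a b c d → a * b - c * d ≡ a * (b - d) + d * (a - c)
  lemma = solve 4 (λ a b c d → a :* b :- c :* d := a :* (b :- d) :+ d :* (a :- c)) refl

_*ᴿ_ : ℝ → ℝ → ℝ
x *ᴿ y = mkℝ (λ n → seq x n * seq y n) λ ε 0<ε →
  let A , 0<A , K₁ , hA = bounded x
      B , 0<B , K₂ , hB = bounded y
      δ , 0<δ , Aδ≡ε/2  = rescale A (½ * ε) 0<A (half>0 0<ε)
      η , 0<η , Bη≡ε/2  = rescale B (½ * ε) 0<B (half>0 0<ε)
      K₃ , hδ           = cauchy y δ 0<δ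
      K₄ , hη           = cauchy x η 0<η
      K₁₂ = K₁ ℕ.⊔ K₂
      K₃₄ = K₃ ℕ.⊔ K₄
  in K₁₂ ℕ.⊔ K₃₄ , λ m n K≤m K≤n →
    ≤-trans
      (*-close (<⇒≤ 0<A) (<⇒≤ 0<B)
        (hA m (ℕ.m⊔n≤o⇒m≤o K₁ K₂ (ℕ.m⊔n≤o⇒m≤o K₁₂ K₃₄ K≤m)))
        (hB n (ℕ.m⊔n≤o⇒n≤o K₁ K₂ (ℕ.m⊔n≤o⇒m≤o K₁₂ K₃₄ K≤n)))
        (hδ m n (ℕ.m⊔n≤o⇒m≤o K₃ K₄ (ℕ.m⊔n≤o⇒n≤o K₁₂ K₃₄ K≤m))
                (ℕ.m⊔n≤o⇒m≤o K₃ K₄ (ℕ.m⊔n≤o⇒n≤o K₁₂ K₃₄ K≤n)))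
        (hη m n (ℕ.m⊔n≤o⇒n≤o K₃ K₄ (ℕ.m⊔n≤o⇒n≤o K₁₂ K₃₄ K≤m))
                (ℕ.m⊔n≤o⇒n≤o K₃ K₄ (ℕ.m⊔n≤o⇒n≤o K₁₂ K₃₄ K≤n))))
      (≤-reflexive (trans (cong₂ _+_ Aδ≡ε/2 Bη≡ε/2) (half+half ε)))

------------------------------------------------------------------------
-- Square roots

-- The integer part of the square root of a natural number.
⌊√_⌋ : ℕ → ℕ
⌊√ zero  ⌋ = 0
⌊√ suc n ⌋ with suc ⌊√ n ⌋ ℕ.* suc ⌊√ n ⌋ ℕ.≤? suc n
... | yes _ = suc ⌊√ n ⌋
... | no  _ = ⌊√ n ⌋

⌊√⌋-lower : ∀ n → ⌊√ n ⌋ ℕ.* ⌊√ n ⌋ ℕ.≤ n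
⌊√⌋-lower zero = ℕ.z≤n
⌊√⌋-lower (suc n) with suc ⌊√ n ⌋ ℕ.* suc ⌊√ n ⌋ ℕ.≤? suc n
... | yes h = h
... | no  _ = ℕ.m≤n⇒m≤1+n (⌊√⌋-lower n)

⌊√⌋-upper : ∀ n → n ℕ.< suc ⌊√ n ⌋ ℕ.* suc ⌊√ n ⌋
⌊√⌋-upper zero = ℕ.s≤s ℕ.z≤n
⌊√⌋-upper (suc n) with suc ⌊√ n ⌋ ℕ.* suc ⌊√ n ⌋ ℕ.≤? suc n
... | no  h = ℕ.≰⇒> h
... | yes h = ℕ.≤-<-trans (⌊√⌋-upper n)
                (ℕ.*-mono-< (ℕ.n<1+n (suc ⌊√ n ⌋)) (ℕ.n<1+n (suc ⌊√ n ⌋)))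

recip : ℕ → ℚ
recip n = ℤ.+ 1 ℚ./ suc n

-- The largest multiple of 1/(n+1) whose square is at most ∣ p ∣.
approx√ : ℚ → ℕ → ℚ
approx√ p n = ℤ.+ numerator ℚ./ suc n
  where
  numerator : ℕ
  numerator = ⌊√ (ℤ.∣ ℚ.↥ p ∣ ℕ.* (suc n ℕ.* suc n)) ℕ./ ℚ.↧ₙ p ⌋

approx√≥0 : ∀ p n → 0ℚ ≤ approx√ p n
approx√≥0 p n = nonNegative⁻¹ (approx√ p n) 
  {{normalize-nonNeg ⌊√ (ℤ.∣ ℚ.↥ p ∣ ℕ.* (suc n ℕ.* suc n)) ℕ./ ℚ.↧ₙ p ⌋ (suc n)}}

toℚᵘ-/ : ∀ i n → ℚ.toℚᵘ (i ℚ./ suc n) ℚᵘ.≃ ℚᵘ.mkℚᵘ i n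
toℚᵘ-/ i n = toℚᵘ-fromℚᵘ (ℚᵘ.mkℚᵘ i n)

/-upper : ∀ m q .{{_ : NonZero q}} → m ℕ.< suc (m ℕ./ q) ℕ.* q
/-upper m q = ℕ.≤-trans
  (ℕ.s≤s (ℕ.≤-reflexive (ℕ.m≡m%n+[m/n]*n m q)))
  (ℕ.+-monoˡ-< (m ℕ./ q ℕ.* q) (ℕ.m%n<n m q))

approx√-lower : ∀ p n → approx√ p n * approx√ p n ≤ ∣ p ∣
approx√-lower p@(mkℚ i d _) n = toℚᵘ-cancel-≤ (begin
  ℚ.toℚᵘ (approx√ p n * approx√ p n)
    ≃⟨ toℚᵘ-homo-* (approx√ p n) (approx√ p n) ⟩
  ℚ.toℚᵘ (approx√ p n) ℚᵘ.* ℚ.toℚᵘ (approx√ p n)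
    ≃⟨ ℚᵘ.*-cong (toℚᵘ-/ (ℤ.+ f) n) (toℚᵘ-/ (ℤ.+ f) n) ⟩
  ℚᵘ.mkℚᵘ (ℤ.+ f) n ℚᵘ.* ℚᵘ.mkℚᵘ (ℤ.+ f) n
    ≤⟨ ℚᵘ.*≤* (subst₂ ℤ._≤_ eqˡ eqʳ (ℤ.+≤+ f²q≤a)) ⟩
  ℚᵘ.mkℚᵘ (ℤ.+ ℤ.∣ i ∣) d ∎)
  where
  open ℚᵘ.≤-Reasoning
  a = ℤ.∣ i ∣ ℕ.* (suc n ℕ.* suc n)
  f = ⌊√ a ℕ./ suc d ⌋
  f²q≤a : f ℕ.* f ℕ.* suc d ℕ.≤ a
  f²q≤a = ℕ.≤-trans (ℕ.*-monoˡ-≤ (suc d) (⌊√⌋-lower (a ℕ./ suc d))) (ℕ.m/n*n≤m a (suc d))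
  eqˡ : ℤ.+ (f ℕ.* f ℕ.* suc d) ≡ (ℤ.+ f ℤ.* ℤ.+ f) ℤ.* ℤ.+ suc d
  eqˡ = trans (ℤ.pos-* (f ℕ.* f) (suc d)) (cong (ℤ._* ℤ.+ suc d) (ℤ.pos-* f f))
  eqʳ : ℤ.+ a ≡ ℤ.+ ℤ.∣ i ∣ ℤ.* ℤ.+ (suc n ℕ.* suc n)
  eqʳ = ℤ.pos-* ℤ.∣ i ∣ (suc n ℕ.* suc n)

suc-/ : ∀ f n → ℤ.+ f ℚ./ suc n + recip n ≡ ℤ.+ suc f ℚ./ suc n
suc-/ f n = toℚᵘ-injective (begin
  ℚ.toℚᵘ (ℤ.+ f ℚ./ suc n + recip n)
    ≈⟨ toℚᵘ-homo-+ (ℤ.+ f ℚ./ suc n) (recip n) ⟩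
  ℚ.toℚᵘ (ℤ.+ f ℚ./ suc n) ℚᵘ.+ ℚ.toℚᵘ (recip n)
    ≈⟨ ℚᵘ.+-cong (toℚᵘ-/ (ℤ.+ f) n) (toℚᵘ-/ (ℤ.+ 1) n) ⟩
  ℚᵘ.mkℚᵘ (ℤ.+ f) n ℚᵘ.+ ℚᵘ.mkℚᵘ (ℤ.+ 1) n
    ≈⟨ ℚᵘ.*≡* (lemma (ℤ.+ f) (ℤ.+ suc n)) ⟩
  ℚᵘ.mkℚᵘ (ℤ.+ suc f) n
    ≈⟨ toℚᵘ-/ (ℤ.+ suc f) n ⟨
  ℚ.toℚᵘ (ℤ.+ suc f ℚ./ suc n) ∎)
  where
  open import Relation.Binary.Reasoning.Setoid ℚᵘ.≃-setoid
  open ℤ.+-*-Solver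
  lemma : ∀ x k → (x ℤ.* k ℤ.+ ℤ.+ 1 ℤ.* k) ℤ.* k ≡ (ℤ.+ 1 ℤ.+ x) ℤ.* (k ℤ.* k)
  lemma = solve 2 (λ x k → (x :* k :+ con (ℤ.+ 1) :* k) :* k := (con (ℤ.+ 1) :+ x) :* (k :* k)) refl

approx√-upper : ∀ p n → ∣ p ∣ < (approx√ p n + recip n) * (approx√ p n + recip n)
approx√-upper p@(mkℚ i d _) n = toℚᵘ-cancel-< (begin-strict
  ℚᵘ.mkℚᵘ (ℤ.+ ℤ.∣ i ∣) d
    <⟨ ℚᵘ.*<* (subst₂ ℤ._<_ eqˡ eqʳ (ℤ.+<+ a<f²q)) ⟩
  ℚᵘ.mkℚᵘ (ℤ.+ suc f) n ℚᵘ.* ℚᵘ.mkℚᵘ (ℤ.+ suc f) n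
    ≃⟨ ℚᵘ.*-cong (toℚᵘ-/ (ℤ.+ suc f) n) (toℚᵘ-/ (ℤ.+ suc f) n) ⟨
  ℚ.toℚᵘ t ℚᵘ.* ℚ.toℚᵘ t
    ≃⟨ toℚᵘ-homo-* t t ⟨
  ℚ.toℚᵘ (t * t)
    ≡⟨ cong ℚ.toℚᵘ (cong₂ _*_ (suc-/ f n) (suc-/ f n)) ⟨
  ℚ.toℚᵘ ((approx√ p n + recip n) * (approx√ p n + recip n)) ∎)
  where
  open ℚᵘ.≤-Reasoning
  a = ℤ.∣ i ∣ ℕ.* (suc n ℕ.* suc n)
  f = ⌊√ a ℕ./ suc d ⌋
  t = ℤ.+ suc f ℚ./ suc n
  a<f²q : a ℕ.< suc f ℕ.* suc f ℕ.* suc d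
  a<f²q = ℕ.<-≤-trans (/-upper a (suc d))
                      (ℕ.*-monoˡ-≤ (suc d) (⌊√⌋-upper (a ℕ./ suc d)))
  eqˡ : ℤ.+ a ≡ ℤ.+ ℤ.∣ i ∣ ℤ.* ℤ.+ (suc n ℕ.* suc n)
  eqˡ = ℤ.pos-* ℤ.∣ i ∣ (suc n ℕ.* suc n)
  eqʳ : ℤ.+ (suc f ℕ.* suc f ℕ.* suc d) ≡ (ℤ.+ suc f ℤ.* ℤ.+ suc f) ℤ.* ℤ.+ suc d
  eqʳ = trans (ℤ.pos-* (suc f ℕ.* suc f) (suc d))
              (cong (ℤ._* ℤ.+ suc d) (ℤ.pos-* (suc f) (suc f)))

recip-small : ∀ ε → 0ℚ < ε → ∃ λ K → ∀ n → K ℕ.≤ n → recip n ≤ ε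
recip-small ε@(mkℚ (ℤ.+ zero) d _) (*<* h) = contradiction h (ℤ.<-irrefl refl)
recip-small ε@(mkℚ (ℤ.+ suc k) d _) _ = d , λ n d≤n → toℚᵘ-cancel-≤
  (ℚᵘ.≤-respˡ-≃ (ℚᵘ.≃-sym (toℚᵘ-/ (ℤ.+ 1) n))
    (ℚᵘ.*≤* (ℤ.+≤+ (ℕ.*-mono-≤ {1} {suc k} (ℕ.s≤s ℕ.z≤n) (ℕ.s≤s d≤n)))))

approx√-gap : ∀ p q m n δ → 0ℚ < δ → ∣ p ∣ ≤ ∣ q ∣ + δ * δ → recip n ≤ δ →
              approx√ p m ≤ approx√ q n + (δ + δ)
approx√-gap p q m n δ 0<δ p≤q+δ² r≤δ = ≮⇒≥ λ t+2δ<s → <-irrefl refl (begin-strict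
  (t + (δ + δ)) * (t + (δ + δ)) ≤⟨ *-mono-≤-nonNeg 0≤t+2δ 0≤s (<⇒≤ t+2δ<s) (<⇒≤ t+2δ<s) ⟩
  s * s                         ≤⟨ approx√-lower p m ⟩
  ∣ p ∣                         ≤⟨ p≤q+δ² ⟩
  ∣ q ∣ + δ * δ                 <⟨ +-monoˡ-< (δ * δ) (approx√-upper q n) ⟩
  (t + r) * (t + r) + δ * δ     ≤⟨ +-monoˡ-≤ (δ * δ) (*-mono-≤-nonNeg 0≤t+r 0≤t+δ t+r≤t+δ t+r≤t+δ) ⟩
  (t + δ) * (t + δ) + δ * δ     ≡⟨ +-identityʳ _ ⟨
  (t + δ) * (t + δ) + δ * δ + 0ℚ
    ≤⟨ +-monoʳ-≤ ((t + δ) * (t + δ) + δ * δ) (+-mono-≤ 0≤δ[t+δ] 0≤δ[t+δ]) ⟩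
  (t + δ) * (t + δ) + δ * δ + (δ * (t + δ) + δ * (t + δ))
                                ≡⟨ lemma t δ ⟩
  (t + (δ + δ)) * (t + (δ + δ)) ∎)
  where
  open ≤-Reasoning
  open +-*-Solver
  s = approx√ p m
  t = approx√ q n
  r = recip n
  0≤s = approx√≥0 p m
  0≤t = approx√≥0 q n
  0≤δ = <⇒≤ 0<δ
  0≤r : 0ℚ ≤ r
  0≤r = nonNegative⁻¹ r {{normalize-nonNeg 1 (suc n)}}
  0≤t+r : 0ℚ ≤ t + r
  0≤t+r = +-mono-≤ 0≤t 0≤r
  0≤t+δ : 0ℚ ≤ t + δ
  0≤t+δ = +-mono-≤ 0≤t 0≤δ
  0≤t+2δ : 0ℚ ≤ t + (δ + δ)
  0≤t+2δ = +-mono-≤ 0≤t (+-mono-≤ 0≤δ 0≤δ)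
  t+r≤t+δ : t + r ≤ t + δ
  t+r≤t+δ = +-monoʳ-≤ t r≤δ
  0≤δ[t+δ] : 0ℚ ≤ δ * (t + δ)
  0≤δ[t+δ] = ≤-trans (≤-reflexive (sym (*-zeroˡ 0ℚ)))
                     (*-mono-≤-nonNeg {0ℚ} {δ} {0ℚ} ≤-refl 0≤δ 0≤δ 0≤t+δ)
  lemma : ∀ t δ → (t + δ) * (t + δ) + δ * δ + (δ * (t + δ) + δ * (t + δ))
                  ≡ (t + (δ + δ)) * (t + (δ + δ))
  lemma = solve 2 (λ t δ →
    (t :+ δ) :* (t :+ δ) :+ δ :* δ :+ (δ :* (t :+ δ) :+ δ :* (t :+ δ))
      := (t :+ (δ :+ δ)) :* (t :+ (δ :+ δ))) refl

-- The square root of the absolute value of x.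
√_ : ℝ → ℝ
√ x = mkℝ (λ n → approx√ (seq x n) n) λ ε 0<ε →
  let δ = ½ * ε
      0<δ = half>0 0<ε
      0<δ² = positive⁻¹ (δ * δ) {{pos*pos⇒pos δ {{ℚ.positive 0<δ}} δ {{ℚ.positive 0<δ}}}}
      K₁ , h = cauchy x (δ * δ) 0<δ²
      K₂ , r = recip-small δ 0<δ
      gap : ∀ m n → K₁ ℕ.⊔ K₂ ℕ.≤ m → K₁ ℕ.⊔ K₂ ℕ.≤ n →
            approx√ (seq x m) m ≤ approx√ (seq x n) n + ε
      gap = λ m n K≤m K≤n → ≤-trans
        (approx√-gap (seq x m) (seq x n) m n δ 0<δ
          (≤-trans (∣p∣≤∣q∣+∣p-q∣ (seq x m) (seq x n))
                   (+-monoʳ-≤ ∣ seq x n ∣ (h m n (ℕ.m⊔n≤o⇒m≤o K₁ K₂ K≤m) (ℕ.m⊔n≤o⇒m≤o K₁ K₂ K≤n))))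
          (r n (ℕ.m⊔n≤o⇒n≤o K₁ K₂ K≤n)))
        (≤-reflexive (cong (approx√ (seq x n) n +_) (half+half ε)))
  in K₁ ℕ.⊔ K₂ , λ m n K≤m K≤n → ∣p-q∣≤r (gap m n K≤m K≤n) (gap n m K≤n K≤m)

√-nonNeg : ∀ x → 0ᴿ ≤ᴿ √ x
√-nonNeg x ε 0<ε = 0 , λ n _ → +-mono-≤ (approx√≥0 (seq x n) n) (<⇒≤ 0<ε)

∣p∣≤p+2ε : ∀ p ε → 0ℚ ≤ ε → 0ℚ ≤ p + ε → ∣ p ∣ ≤ p + (ε + ε)
∣p∣≤p+2ε p ε 0≤ε 0≤p+ε with ∣p∣≡p∨∣p∣≡-p p
... | inj₁ e = ≤-trans (≤-reflexive (trans e (sym (+-identityʳ p)))) (+-monoʳ-≤ p (+-mono-≤ 0≤ε 0≤ε))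
... | inj₂ e = begin
  ∣ p ∣                         ≡⟨ trans e (sym (+-identityʳ (- p))) ⟩
  - p + 0ℚ                      ≤⟨ +-monoʳ-≤ (- p) (+-mono-≤ 0≤p+ε 0≤p+ε) ⟩
  - p + ((p + ε) + (p + ε))     ≡⟨ lemma p ε ⟩
  p + (ε + ε) ∎
  where
  open ≤-Reasoning
  open +-*-Solver
  lemma : ∀ p ε → - p + ((p + ε) + (p + ε)) ≡ p + (ε + ε)
  lemma = solve 2 (λ p ε → :- p :+ ((p :+ ε) :+ (p :+ ε)) := p :+ (ε :+ ε)) refl

approx√-close : ∀ p n B δ → 0ℚ ≤ B → ∣ approx√ p n ∣ ≤ B → recip n ≤ 1ℚ → recip n ≤ δ →
                ∣ p ∣ ≤ approx√ p n * approx√ p n + (B + B + 1ℚ) * δ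
approx√-close p n B δ 0≤B s≤B r≤1 r≤δ = begin
  ∣ p ∣                              ≤⟨ <⇒≤ (approx√-upper p n) ⟩
  (s + r) * (s + r)                  ≡⟨ lemma s r ⟩
  s * s + (s + s + r) * r            ≤⟨ +-monoʳ-≤ (s * s) (*-mono-≤-nonNeg 0≤r 0≤2B+1
                                          (+-mono-≤ (+-mono-≤ s≤B′ s≤B′) r≤1) r≤δ) ⟩
  s * s + (B + B + 1ℚ) * δ           ∎
  where
  open ≤-Reasoning
  open +-*-Solver
  s = approx√ p n
  r = recip n
  0≤r : 0ℚ ≤ r
  0≤r = nonNegative⁻¹ r {{normalize-nonNeg 1 (suc n)}}
  s≤B′ : s ≤ B
  s≤B′ = ≤-trans (p≤∣p∣ s) s≤B
  0≤2B+1 : 0ℚ ≤ B + B + 1ℚ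
  0≤2B+1 = +-mono-≤ (+-mono-≤ 0≤B 0≤B) (nonNegative⁻¹ 1ℚ)
  lemma : ∀ s r → (s + r) * (s + r) ≡ s * s + (s + s + r) * r
  lemma = solve 2 (λ s r → (s :+ r) :* (s :+ r) := s :* s :+ (s :+ s :+ r) :* r) refl

√-square : ∀ x → 0ᴿ ≤ᴿ x → √ x *ᴿ √ x ≃ x
√-square x 0≤x ε 0<ε =
  let K₁ , h = 0≤x (½ * ε) (half>0 0<ε)
      B , 0<B , K₂ , hB = bounded (√ x)
      0<2B+1 = +-mono-< (+-mono-< 0<B 0<B) (positive⁻¹ 1ℚ)
      δ , 0<δ , eq = rescale (B + B + 1ℚ) ε 0<2B+1 0<ε
      K₃ , r₁ = recip-small 1ℚ (positive⁻¹ 1ℚ)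
      K₄ , rδ = recip-small δ 0<δ
      K₁₂ = K₁ ℕ.⊔ K₂
      K₃₄ = K₃ ℕ.⊔ K₄
  in K₁₂ ℕ.⊔ K₃₄ , λ n K≤n →
    let p = seq x n
        K₁₂≤n = ℕ.m⊔n≤o⇒m≤o K₁₂ K₃₄ K≤n
        K₃₄≤n = ℕ.m⊔n≤o⇒n≤o K₁₂ K₃₄ K≤n
    in ∣p-q∣≤r
      (≤-trans (approx√-lower p n)
        (≤-trans (∣p∣≤p+2ε p (½ * ε) (<⇒≤ (half>0 0<ε)) (h n (ℕ.m⊔n≤o⇒m≤o K₁ K₂ K₁₂≤n)))
                 (≤-reflexive (cong (p +_) (half+half ε)))))
      (≤-trans (p≤∣p∣ p)
        (≤-trans (approx√-close p n B δ (<⇒≤ 0<B) (hB n (ℕ.m⊔n≤o⇒n≤o K₁ K₂ K₁₂≤n))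
                   (r₁ n (ℕ.m⊔n≤o⇒m≤o K₃ K₄ K₃₄≤n)) (rδ n (ℕ.m⊔n≤o⇒n≤o K₃ K₄ K₃₄≤n)))
                 (≤-reflexive (cong (approx√ p n * approx√ p n +_) eq))))

------------------------------------------------------------------------
-- Euclidean space

-- A vector indexed by Fin n is a function Fin n → ℝ.
Σᴿ : ∀ {n} → Vector ℝ n → ℝ
Σᴿ = foldr _+ᴿ_ 0ᴿ

Σᴺ : ∀ {n} → Vector ℕ n → ℕ
Σᴺ = foldr ℕ._+_ 0

⟨_,_⟩ : ∀ {n} → Vector ℝ n → Vector ℝ n → ℝ
⟨ α , β ⟩ = Σᴿ λ v → α v *ᴿ β v

‖_‖ : ∀ {n} → Vector ℝ n → ℝ
‖ α ‖ = √ ⟨ α , α ⟩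

𝟙 : ∀ {n} → Vector ℝ n
𝟙 _ = 1ᴿ

------------------------------------------------------------------------
-- Graphs

-- Vertices and edge labels are numbered from 0.  A fixed point (v , i) of
-- rot is a self-loop using the single label i at v.
record Graph (N D : ℕ) : Set where
  field
    rot            : Fin N × Fin D → Fin N × Fin D
    rot-involutive : ∀ e → rot (rot e) ≡ e

open Graph public

_≟ᴱ_ : ∀ {N D} → DecidableEquality (Fin N × Fin D)
_≟ᴱ_ = Product.≡-dec Fin._≟_ Fin._≟_

-- The number of pairs (i , j) with rot (u , i) ≡ (v , j).
edges : ∀ {N D} → Graph N D → Fin N → Fin N → ℕ
edges G u v =
  Σᴺ λ i → Σᴺ λ j → if does (rot G (u , i) ≟ᴱ (v , j)) then 1 else 0

adjacency : ∀ {N D} .{{_ : NonZero D}} → Graph N D → Fin N → Fin N → ℝ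
adjacency {D = D} G u v = fromℚ (ℤ.+ edges G u v ℚ./ D)

_·_ : ∀ {N} → (Fin N → Fin N → ℝ) → Vector ℝ N → Vector ℝ N
(M · α) u = Σᴿ λ v → M u v *ᴿ α v

-- SecondEigenvalue≤ G μ says that λ(G) ≤ μ, where λ(G) is the maximum of
-- ‖ M · α ‖ / ‖ α ‖ over the nonzero α orthogonal to 𝟙, and 0 if N ≡ 1: a
-- maximum is at most μ when all the values it is taken over are.
SecondEigenvalue≤ : ∀ {N D} .{{_ : NonZero D}} → Graph N D → ℝ → Set
SecondEigenvalue≤ {N} G μ =
  (N ≡ 1 → 0ᴿ ≤ᴿ μ) ×
  (∀ (α : Vector ℝ N) → ⟨ α , 𝟙 ⟩ ≃ 0ᴿ → ¬ (∀ v → α v ≃ 0ᴿ) →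
     ‖ adjacency G · α ‖ ≤ᴿ μ *ᴿ ‖ α ‖)

Is[_,_,_]-graph : ∀ N D → ℝ → .{{_ : NonZero D}} → Graph N D → Set
Is[ N , D , μ ]-graph G = SecondEigenvalue≤ {N} {D} G μ

-- C is the D-cycle with an arbitrary edge labelling: the two labels at i lead
-- to i + 1 and i - 1 modulo D in one order or the other.
IsCycle : ∀ {D} .{{_ : NonZero D}} → Graph D 2 → Set
IsCycle {D} C = ∀ i →
  (neighbour i Fin.zero ≡ next i × neighbour i (Fin.suc Fin.zero) ≡ prev i) ⊎
  (neighbour i Fin.zero ≡ prev i × neighbour i (Fin.suc Fin.zero) ≡ next i)
  where
  neighbour : Fin D → Fin 2 → Fin D
  neighbour i a = proj₁ (rot C (i , a))
  next prev : Fin D → Fin D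
  next i = suc (toℕ i) ℕ.mod D
  prev i = (toℕ i ℕ.+ ℕ.pred D) ℕ.mod D

------------------------------------------------------------------------
-- The zig-zag product

zigzagRot : ∀ {N₁ D₁ D₂} → Graph N₁ D₁ → Graph D₁ D₂ →
            (Fin N₁ × Fin D₁) × (Fin D₂ × Fin D₂) →
            (Fin N₁ × Fin D₁) × (Fin D₂ × Fin D₂)
zigzagRot G₁ G₂ ((v , k) , (i , j)) =
  let k′ , i′ = rot G₂ (k , i)
      w  , ℓ′ = rot G₁ (v , k′)
      ℓ  , j′ = rot G₂ (ℓ′ , j)
  in (w , ℓ) , (j′ , i′)

zigzagRot-involutive : ∀ {N₁ D₁ D₂} (G₁ : Graph N₁ D₁) (G₂ : Graph D₁ D₂) →
                       ∀ e → zigzagRot G₁ G₂ (zigzagRot G₁ G₂ e) ≡ e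
zigzagRot-involutive G₁ G₂ ((v , k) , (i , j))
  rewrite rot-involutive G₂ (proj₂ (rot G₁ (v , proj₁ (rot G₂ (k , i)))) , j)
        | rot-involutive G₁ (v , proj₁ (rot G₂ (k , i)))
        | rot-involutive G₂ (k , i)
        = refl

-- The vertices Fin N₁ × Fin D₁ and labels Fin D₂ × Fin D₂ are numbered by
-- the standard bijections combine/remQuot.
infixl 7 _ⓩ_

_ⓩ_ : ∀ {N₁ D₁ D₂} → Graph N₁ D₁ → Graph D₁ D₂ → Graph (N₁ ℕ.* D₁) (D₂ ℕ.* D₂)
_ⓩ_ {N₁} {D₁} {D₂} G₁ G₂ = record
  { rot            = λ e → encode (zigzagRot G₁ G₂ (decode e))
  ; rot-involutive = λ e →
      trans (cong (λ x → encode (zigzagRot G₁ G₂ x)) (decode-encode (zigzagRot G₁ G₂ (decode e))))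
            (trans (cong encode (zigzagRot-involutive G₁ G₂ (decode e))) (encode-decode e))
  }
  where
  encode : (Fin N₁ × Fin D₁) × (Fin D₂ × Fin D₂) → Fin (N₁ ℕ.* D₁) × Fin (D₂ ℕ.* D₂)
  encode ((v , k) , (i , j)) = combine v k , combine i j
  decode : Fin (N₁ ℕ.* D₁) × Fin (D₂ ℕ.* D₂) → (Fin N₁ × Fin D₁) × (Fin D₂ × Fin D₂)
  decode (x , y) = remQuot {N₁} D₁ x , remQuot {D₂} D₂ y
  decode-encode : ∀ e → decode (encode e) ≡ e
  decode-encode ((v , k) , (i , j)) = cong₂ _,_ (Fin.remQuot-combine v k) (Fin.remQuot-combine i j)
  encode-decode : ∀ e → encode (decode e) ≡ e
  encode-decode (x , y) = cong₂ _,_ (Fin.combine-remQuot {N₁} D₁ x) (Fin.combine-remQuot {D₂} D₂ y)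

{-# OPTIONS --safe #-}

-- Write B for the walk on the cycle, acting on every cloud {v} × [D], and A for
-- the rotation of G, so that the zig-zag product has the adjacency operator
-- B A B.  Let a be the vector of cloud means of f and g = f - a.  As D is odd, B
-- contracts the vectors of mean zero: ‖B h‖² ≤ ‖h‖² - η ‖h - mean h‖².  So with
-- γ = A B f, either g is not small and norm is lost in the first B, or g is small,
-- the cloud means of γ are close to M a for the adjacency operator M of G, hence
-- short, and norm is lost in the second B.  Weighing the two cases,
-- ‖B A B f‖² ≤ (1 - η t²/4) ‖f‖² for f orthogonal to 𝟙, where 1 - 2t ≥ λ(G).
--
-- All of this is carried out for rational vectors, on which the hypothesis gives
-- ‖M a‖² ≤ (1 - 2t) ‖a‖².  A Cauchy sequence of vectors orthogonal to 𝟙 in the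
-- limit need not be orthogonal to 𝟙 termwise, so the estimates are for arbitrary
-- rational vectors f, with the error term (Σ f)².
module Submission where

open import Defs
open import Algebra using (CommutativeRing)
open import Data.Nat as ℕ using (ℕ; zero; suc; NonZero; _%_; _/_)
import Data.Nat.Properties as ℕ
import Data.Nat.DivMod as ℕ
open import Data.Nat.Solver as ℕ-Solver using ()
import Data.Integer as ℤ
import Data.Integer.Properties as ℤ
open import Data.Rational as ℚ
  using (ℚ; 0ℚ; 1ℚ; ½; _+_; _-_; -_; _≤_; _<_; ∣_∣; _⊓_)
open import Data.Rational.Properties as ℚ hiding (_≟_)
import Data.Rational.Unnormalised as ℚᵘ
import Data.Rational.Unnormalised.Properties as ℚᵘ
open import Data.Rational.Solver using (module +-*-Solver)
open import Data.Fin as Fin using (Fin; toℕ; combine; remQuot; _↑ˡ_; _↑ʳ_)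
import Data.Fin.Properties as Fin
open import Data.Fin.Permutation using (permutation)
open import Data.Bool using (if_then_else_)
open import Data.Product using (∃; ∃-syntax; _×_; _,_; proj₁; proj₂; uncurry)
open import Data.Sum using (inj₁; inj₂)
open import Function using (_∘_)
open import Relation.Nullary using (¬_; Dec; yes; no; does; contradiction)
open import Relation.Nullary.Decidable using (from-yes)
open import Relation.Binary.PropositionalEquality
open import Algebra.Properties.Semiring.Sum (CommutativeRing.semiring +-*-commutativeRing)

-- Inequalities and finite sums over the rationals

module FiniteSums where

  open import Data.Rational using (_*_)

  p≤q⇒0≤q-p : ∀ {p q} → p ≤ q → 0ℚ ≤ q - p
  p≤q⇒0≤q-p {p} {q} p≤q = ≤-trans (≤-reflexive (sym (+-inverseʳ p))) (+-monoˡ-≤ (- p) p≤q)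

  0≤q-p⇒p≤q : ∀ {p q} → 0ℚ ≤ q - p → p ≤ q
  0≤q-p⇒p≤q {p} {q} 0≤q-p =
    ≤-trans (≤-reflexive (sym (+-identityʳ p)))
            (≤-trans (+-monoʳ-≤ p 0≤q-p) (≤-reflexive (lemma p q)))
    where
    open +-*-Solver
    lemma : ∀ p q → p + (q - p) ≡ q
    lemma = solve 2 (λ p q → p :+ (q :- p) := q) refl

  0≤p+q : ∀ {p q} → 0ℚ ≤ p → 0ℚ ≤ q → 0ℚ ≤ p + q
  0≤p+q = +-mono-≤

  0≤p*q : ∀ {p q} → 0ℚ ≤ p → 0ℚ ≤ q → 0ℚ ≤ p * q
  0≤p*q {p} {q} 0≤p 0≤q = nonNegative⁻¹ (p * q)
    {{nonNeg*nonNeg⇒nonNeg p {{ℚ.nonNegative 0≤p}} q {{ℚ.nonNegative 0≤q}}}}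

  0≤p² : ∀ p → 0ℚ ≤ p * p
  0≤p² p with ≤-total 0ℚ p
  ... | inj₁ 0≤p = 0≤p*q 0≤p 0≤p
  ... | inj₂ p≤0 = ≤-trans (0≤p*q 0≤-p 0≤-p) (≤-reflexive (lemma p))
    where
    open +-*-Solver
    0≤-p : 0ℚ ≤ - p
    0≤-p = neg-antimono-≤ p≤0
    lemma : ∀ p → - p * - p ≡ p * p
    lemma = solve 1 (λ p → :- p :* :- p := p :* p) refl

  p²≤q²⇒p≤q : ∀ {p q} → 0ℚ ≤ q → p * p ≤ q * q → p ≤ q
  p²≤q²⇒p≤q {p} {q} 0≤q p²≤q² = ≮⇒≥ λ q<p →
    <-irrefl refl (<-≤-trans (≤-<-trans (*-monoˡ-≤-nonNeg q {{ℚ.nonNegative 0≤q}} (<⇒≤ q<p))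
      (*-monoˡ-<-pos p {{ℚ.positive (≤-<-trans 0≤q q<p)}} q<p)) p²≤q²)

  [p+q]²≤2p²+2q² : ∀ p q → (p + q) * (p + q) ≤ p * p + p * p + (q * q + q * q)
  [p+q]²≤2p²+2q² p q = 0≤q-p⇒p≤q (≤-trans (0≤p² (p - q)) (≤-reflexive (lemma p q)))
    where
    open +-*-Solver
    lemma : ∀ p q → (p - q) * (p - q) ≡ p * p + p * p + (q * q + q * q) - (p + q) * (p + q)
    lemma = solve 2 (λ p q → (p :- q) :* (p :- q) :=
              p :* p :+ p :* p :+ (q :* q :+ q :* q) :- (p :+ q) :* (p :+ q)) refl

  sum-mono-≤ : ∀ {n} {f g : Fin n → ℚ} → (∀ i → f i ≤ g i) → sum f ≤ sum g
  sum-mono-≤ {zero}  f≤g = ≤-refl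
  sum-mono-≤ {suc n} f≤g = +-mono-≤ (f≤g Fin.zero) (sum-mono-≤ (f≤g ∘ Fin.suc))

  sum-nonNeg : ∀ {n} {f : Fin n → ℚ} → (∀ i → 0ℚ ≤ f i) → 0ℚ ≤ sum f
  sum-nonNeg {zero}  0≤f = ≤-refl
  sum-nonNeg {suc n} 0≤f = +-mono-≤ (0≤f Fin.zero) (sum-nonNeg (0≤f ∘ Fin.suc))

  term≤sum : ∀ {n} (f : Fin n → ℚ) → (∀ i → 0ℚ ≤ f i) → ∀ i → f i ≤ sum f
  term≤sum f 0≤f Fin.zero =
    ≤-trans (≤-reflexive (sym (+-identityʳ (f Fin.zero))))
            (+-monoʳ-≤ (f Fin.zero) (sum-nonNeg (0≤f ∘ Fin.suc)))
  term≤sum f 0≤f (Fin.suc i) =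
    ≤-trans (term≤sum (f ∘ Fin.suc) (0≤f ∘ Fin.suc) i)
            (≤-trans (≤-reflexive (sym (+-identityˡ _)))
                     (+-monoˡ-≤ (sum (f ∘ Fin.suc)) (0≤f Fin.zero)))

  sum-zero : ∀ {n} {f : Fin n → ℚ} → (∀ i → f i ≡ 0ℚ) → sum f ≡ 0ℚ
  sum-zero {n} f≡0 = trans (sum-cong-≗ f≡0) (sum-replicate-zero n)

  sum-single : ∀ {n} (f : Fin n → ℚ) i → (∀ j → j ≢ i → f j ≡ 0ℚ) → sum f ≡ f i
  sum-single f Fin.zero f≡0 =
    trans (cong (f Fin.zero +_) (sum-zero λ j → f≡0 (Fin.suc j) λ ())) (+-identityʳ _)
  sum-single f (Fin.suc i) f≡0 = trans
    (cong₂ _+_ (f≡0 Fin.zero λ ())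
      (sum-single (f ∘ Fin.suc) i λ j j≢i → f≡0 (Fin.suc j) (j≢i ∘ Fin.suc-injective)))
    (+-identityˡ _)

  sum-↑ : ∀ m {n} (f : Fin (m ℕ.+ n) → ℚ) → sum f ≡ sum (f ∘ (_↑ˡ n)) + sum (f ∘ (m ↑ʳ_))
  sum-↑ zero    f = sym (+-identityˡ _)
  sum-↑ (suc m) f = trans (cong (f Fin.zero +_) (sum-↑ m (f ∘ Fin.suc)))
                          (sym (+-assoc (f Fin.zero) _ _))

  sum-combine : ∀ m {n} (f : Fin (m ℕ.* n) → ℚ) → sum f ≡ ∑[ i < m ] ∑[ j < n ] f (combine i j)
  sum-combine zero        f = refl
  sum-combine (suc m) {n} f = trans (sum-↑ n f) 
    (cong (sum (f ∘ (_↑ˡ m ℕ.* n)) +_) (sum-combine m (f ∘ (n ↑ʳ_))))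

  ∑∑-cong : ∀ {m n} {f g : Fin m → Fin n → ℚ} → (∀ i j → f i j ≡ g i j) →
            ∑[ i < m ] ∑[ j < n ] f i j ≡ ∑[ i < m ] ∑[ j < n ] g i j
  ∑∑-cong f≡g = sum-cong-≗ λ i → sum-cong-≗ (f≡g i)

  -- An involution of the index pairs is a permutation. It is transported along `combine` and
  -- `remQuot` to `Fin (m * n)`, where invariance of a single sum under permutations applies. Every
  -- use takes a rotation map for `ρ`, so this is where the regularity of a graph enters.
  ∑∑-involution : ∀ {m n} (ρ : Fin m × Fin n → Fin m × Fin n) → (∀ e → ρ (ρ e) ≡ e) →
                  (f : Fin m × Fin n → ℚ) →
                  ∑[ i < m ] ∑[ j < n ] f (ρ (i , j)) ≡ ∑[ i < m ] ∑[ j < n ] f (i , j)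
  ∑∑-involution {m} {n} ρ ρρ f = begin
    ∑[ i < m ] ∑[ j < n ] f (ρ (i , j))
      ≡⟨ ∑∑-cong (λ i j → cong f (sym (trans (cong (remQuot n ∘ enc ∘ ρ) (Fin.remQuot-combine i j))
                                             (dec-enc (ρ (i , j)))))) ⟩
    ∑[ i < m ] ∑[ j < n ] f (remQuot n (π (combine i j)))
      ≡⟨ sum-combine m (f ∘ remQuot n ∘ π) ⟨
    sum (f ∘ remQuot n ∘ π)
      ≡⟨ sum-permute (f ∘ remQuot n) (permutation π π ππ ππ) ⟨
    sum (f ∘ remQuot n)
      ≡⟨ sum-combine m (f ∘ remQuot n) ⟩
    ∑[ i < m ] ∑[ j < n ] f (remQuot n (combine i j))
      ≡⟨ ∑∑-cong (λ i j → cong f (Fin.remQuot-combine i j)) ⟩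
    ∑[ i < m ] ∑[ j < n ] f (i , j) ∎
    where
    open ≡-Reasoning
    enc : Fin m × Fin n → Fin (m ℕ.* n)
    enc = uncurry combine
    dec-enc : ∀ e → remQuot n (enc e) ≡ e
    dec-enc (i , j) = Fin.remQuot-combine i j
    π : Fin (m ℕ.* n) → Fin (m ℕ.* n)
    π = enc ∘ ρ ∘ remQuot n
    ππ : ∀ x → π (π x) ≡ x
    ππ x = trans (cong (enc ∘ ρ) (dec-enc (ρ (remQuot n x))))
                 (trans (cong enc (ρρ (remQuot n x))) (Fin.combine-remQuot {m} n x))

  -- The embedding of ℕ into ℚ, in the form of a sum: sizes of index sets, sums of constants and the
  -- edge counts made by `Σᴺ` are then all handled by the laws of `sum`.
  card : ℕ → ℚ
  card n = ∑[ _ < n ] 1ℚ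

  card-+ : ∀ m n → card (m ℕ.+ n) ≡ card m + card n
  card-+ m n = sum-↑ m (λ _ → 1ℚ)

  card-Σᴺ : ∀ {n} (f : Fin n → ℕ) → card (Σᴺ f) ≡ ∑[ i < n ] card (f i)
  card-Σᴺ {zero}  f = refl
  card-Σᴺ {suc n} f = trans (card-+ (f Fin.zero) (Σᴺ (f ∘ Fin.suc)))
    (cong (card (f Fin.zero) +_) (card-Σᴺ (f ∘ Fin.suc)))

  sum-const : ∀ {n} p → ∑[ _ < n ] p ≡ card n * p
  sum-const {n} p = trans (sum-cong-≗ {n} λ _ → sym (*-identityˡ p))
                          (sym (*-distribʳ-sum p (λ (_ : Fin n) → 1ℚ)))

  m/n≡card : ∀ m d → ℤ.+ m ℚ./ suc d ≡ card m * recip d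
  m/n≡card zero d = trans
    (toℚᵘ-injective (ℚᵘ.≃-trans (toℚᵘ-/ (ℤ.+ 0) d) (ℚᵘ.*≡* refl)))
    (sym (*-zeroˡ (recip d)))
  m/n≡card (suc m) d = begin
    ℤ.+ suc m ℚ./ suc d           ≡⟨ suc-/ m d ⟨
    ℤ.+ m ℚ./ suc d + recip d     ≡⟨ cong (_+ recip d) (m/n≡card m d) ⟩
    card m * recip d + recip d    ≡⟨ lemma (card m) (recip d) ⟩
    (1ℚ + card m) * recip d       ∎
    where
    open ≡-Reasoning
    open +-*-Solver
    lemma : ∀ c r → c * r + r ≡ (1ℚ + c) * r
    lemma = solve 2 (λ c r → c :* r :+ r := (con 1ℚ :+ c) :* r) refl

  m/n≡card*recip : ∀ m n .{{_ : NonZero n}} → ℤ.+ m ℚ./ n ≡ card m * recip (ℕ.pred n)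
  m/n≡card*recip m (suc d) = m/n≡card m d

  card*recip : ∀ d → card (suc d) * recip d ≡ 1ℚ
  card*recip d = trans (sym (m/n≡card (suc d) d))
    (toℚᵘ-injective (ℚᵘ.≃-trans (toℚᵘ-/ (ℤ.+ suc d) d) (ℚᵘ.*≡* (ℤ.*-comm (ℤ.+ suc d) (ℤ.+ 1)))))

-- Means, deviations and the spectral gap of an odd cycle

module OddCycle where

  open import Data.Rational using (_*_)
  open FiniteSums

  neighbour : ∀ {N D} → Graph N D → Fin N → Fin D → Fin N
  neighbour G v i = proj₁ (rot G (v , i))

  normSq : ∀ {n} → (Fin n → ℚ) → ℚ
  normSq f = sum λ i → f i * f i

  -- recip k is 1/(k+1).
  mean : ∀ {n} → (Fin n → ℚ) → ℚ
  mean {n} f = recip (ℕ.pred n) * sum f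

  card*mean : ∀ {d} (f : Fin (suc d) → ℚ) → card (suc d) * mean f ≡ sum f
  card*mean {d} f = trans (sym (*-assoc (card (suc d)) (recip d) (sum f)))
                          (trans (cong (_* sum f) (card*recip d)) (*-identityˡ (sum f)))

  -- The squared distance from f to the constant vectors.
  deviation : ∀ {d} → (Fin (suc d) → ℚ) → ℚ
  deviation {d} f = normSq f - card (suc d) * (mean f * mean f)

  card-nonNeg : ∀ n → 0ℚ ≤ card n
  card-nonNeg n = sum-nonNeg {n} λ _ → nonNegative⁻¹ 1ℚ

  normSq-nonNeg : ∀ {n} (f : Fin n → ℚ) → 0ℚ ≤ normSq f
  normSq-nonNeg f = sum-nonNeg λ i → 0≤p² (f i)

  normSq-shift : ∀ {n} (f : Fin n → ℚ) c →
                 normSq (λ i → f i - c) ≡ normSq f - (c + c) * sum f + card n * (c * c)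
  normSq-shift {n} f c = begin
    normSq (λ i → f i - c)
      ≡⟨ sum-cong-≗ (λ i → lemma₁ (f i) c) ⟩
    ∑[ i < n ] (f i * f i + ((- (c + c)) * f i + c * c))
      ≡⟨ ∑-distrib-+ (λ i → f i * f i) (λ i → (- (c + c)) * f i + c * c) ⟩
    normSq f + ∑[ i < n ] ((- (c + c)) * f i + c * c)
      ≡⟨ cong (normSq f +_) (∑-distrib-+ (λ i → (- (c + c)) * f i) (λ _ → c * c)) ⟩
    normSq f + (∑[ i < n ] ((- (c + c)) * f i) + ∑[ i < n ] (c * c))
      ≡⟨ cong (normSq f +_) (cong₂ _+_ (sym (*-distribˡ-sum (- (c + c)) f)) (sum-const {n} (c * c))) ⟩
    normSq f + ((- (c + c)) * sum f + card n * (c * c))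
      ≡⟨ lemma₂ (normSq f) c (sum f) (card n) ⟩
    normSq f - (c + c) * sum f + card n * (c * c) ∎
    where
    open ≡-Reasoning
    open +-*-Solver
    lemma₁ : ∀ x c → (x - c) * (x - c) ≡ x * x + ((- (c + c)) * x + c * c)
    lemma₁ = solve 2 (λ x c → (x :- c) :* (x :- c) := x :* x :+ ((:- (c :+ c)) :* x :+ c :* c)) refl
    lemma₂ : ∀ a c s n → a + ((- (c + c)) * s + n * (c * c)) ≡ a - (c + c) * s + n * (c * c)
    lemma₂ = solve 4 (λ a c s n → a :+ ((:- (c :+ c)) :* s :+ n :* (c :* c))
                                 := a :- (c :+ c) :* s :+ n :* (c :* c)) refl

  -- Pythagoras: `f - mean f` is orthogonal to the constants. In particular the mean is the constant
  -- nearest to `f`, so the deviation may be estimated from above with any other constant.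
  normSq-shift-deviation : ∀ {d} (f : Fin (suc d) → ℚ) c →
    normSq (λ i → f i - c) ≡ deviation f + card (suc d) * ((mean f - c) * (mean f - c))
  normSq-shift-deviation {d} f c = begin
    normSq (λ i → f i - c)
      ≡⟨ normSq-shift f c ⟩
    normSq f - (c + c) * sum f + n * (c * c)
      ≡⟨ cong (λ s → normSq f - (c + c) * s + n * (c * c)) (card*mean f) ⟨
    normSq f - (c + c) * (n * mean f) + n * (c * c)
      ≡⟨ lemma (normSq f) c n (mean f) ⟩
    deviation f + n * ((mean f - c) * (mean f - c)) ∎
    where
    open ≡-Reasoning
    open +-*-Solver
    n = card (suc d)
    lemma : ∀ a c n m → a - (c + c) * (n * m) + n * (c * c) ≡ a - n * (m * m) + n * ((m - c) * (m - c))
    lemma = solve 4 (λ a c n m → a :- (c :+ c) :* (n :* m) :+ n :* (c :* c)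
                               := a :- n :* (m :* m) :+ n :* ((m :- c) :* (m :- c))) refl

  deviation≡ : ∀ {d} (f : Fin (suc d) → ℚ) → normSq (λ i → f i - mean f) ≡ deviation f
  deviation≡ {d} f = trans (normSq-shift-deviation f (mean f)) (lemma (deviation f) (card (suc d)) (mean f))
    where
    open +-*-Solver
    lemma : ∀ a n m → a + n * ((m - m) * (m - m)) ≡ a
    lemma = solve 3 (λ a n m → a :+ n :* ((m :- m) :* (m :- m)) := a) refl

  deviation≤normSq-shift : ∀ {d} (f : Fin (suc d) → ℚ) c → deviation f ≤ normSq (λ i → f i - c)
  deviation≤normSq-shift {d} f c = begin
    deviation f         ≡⟨ +-identityʳ (deviation f) ⟨
    deviation f + 0ℚ    ≤⟨ +-monoʳ-≤ (deviation f) (0≤p*q (card-nonNeg (suc d)) (0≤p² (mean f - c))) ⟩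
    deviation f + card (suc d) * ((mean f - c) * (mean f - c)) ≡⟨ normSq-shift-deviation f c ⟨
    normSq (λ i → f i - c) ∎
    where open ≤-Reasoning

  deviation-nonNeg : ∀ {d} (f : Fin (suc d) → ℚ) → 0ℚ ≤ deviation f
  deviation-nonNeg f = ≤-trans (normSq-nonNeg λ i → f i - mean f) (≤-reflexive (deviation≡ f))

  -- The walk on the cycle and its energy

  walk : ∀ {n} → Graph n 2 → (Fin n → ℚ) → Fin n → ℚ
  walk C g k = ½ * (g (neighbour C k Fin.zero) + g (neighbour C k (Fin.suc Fin.zero)))

  -- A Dirichlet form of the two-step walk: on the cycle, the two neighbours of `k` are two steps
  -- apart.
  energy : ∀ {n} → Graph n 2 → (Fin n → ℚ) → ℚ
  energy C g = normSq λ k → g (neighbour C k Fin.zero) - g (neighbour C k (Fin.suc Fin.zero))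

  energy-nonNeg : ∀ {n} (C : Graph n 2) g → 0ℚ ≤ energy C g
  energy-nonNeg C g = normSq-nonNeg λ k → g (neighbour C k Fin.zero) - g (neighbour C k (Fin.suc Fin.zero))

  -- The parallelogram law at each vertex `k`, applied to the values of `g` at its two neighbours.
  -- Summed over `k`, these values run through every vertex twice, because `rot C` permutes the
  -- pairs of a vertex and a label.
  walk-energy : ∀ {n} (C : Graph n 2) g → normSq (walk C g) + ½ * ½ * energy C g ≡ normSq g
  walk-energy {n} C g = begin
    normSq (walk C g) + ½ * ½ * energy C g
      ≡⟨ cong (normSq (walk C g) +_) (*-distribˡ-sum (½ * ½) λ k → (x k - y k) * (x k - y k)) ⟩
    normSq (walk C g) + ∑[ k < n ] (½ * ½ * ((x k - y k) * (x k - y k)))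
      ≡⟨ ∑-distrib-+ (λ k → walk C g k * walk C g k) (λ k → ½ * ½ * ((x k - y k) * (x k - y k))) ⟨
    ∑[ k < n ] (walk C g k * walk C g k + ½ * ½ * ((x k - y k) * (x k - y k)))
      ≡⟨ sum-cong-≗ (λ k → lemma₁ (x k) (y k)) ⟩
    ∑[ k < n ] (½ * (x k * x k + (y k * y k + 0ℚ)))
      ≡⟨ *-distribˡ-sum ½ (λ k → x k * x k + (y k * y k + 0ℚ)) ⟨
    ½ * (∑[ k < n ] ∑[ i < 2 ] (g (neighbour C k i) * g (neighbour C k i)))
      ≡⟨ cong (½ *_) (∑∑-involution (rot C) (rot-involutive C) (λ e → g (proj₁ e) * g (proj₁ e))) ⟩
    ½ * (∑[ k < n ] ∑[ i < 2 ] (g k * g k))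
      ≡⟨ *-distribˡ-sum ½ (λ k → ∑[ i < 2 ] (g k * g k)) ⟩
    ∑[ k < n ] (½ * (g k * g k + (g k * g k + 0ℚ)))
      ≡⟨ sum-cong-≗ (λ k → lemma₂ (g k)) ⟩
    normSq g ∎
    where
    open ≡-Reasoning
    open +-*-Solver
    x y : Fin n → ℚ
    x k = g (neighbour C k Fin.zero)
    y k = g (neighbour C k (Fin.suc Fin.zero))
    lemma₁ : ∀ x y → ½ * (x + y) * (½ * (x + y)) + ½ * ½ * ((x - y) * (x - y)) ≡ ½ * (x * x + (y * y + 0ℚ))
    lemma₁ = solve 2 (λ x y → con ½ :* (x :+ y) :* (con ½ :* (x :+ y)) :+ con ½ :* con ½ :* ((x :- y) :* (x :- y))
                            := con ½ :* (x :* x :+ (y :* y :+ con 0ℚ))) refl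
    lemma₂ : ∀ z → ½ * (z * z + (z * z + 0ℚ)) ≡ z * z
    lemma₂ = solve 1 (λ z → con ½ :* (z :* z :+ (z :* z :+ con 0ℚ)) := z :* z) refl

  -- Residues modulo D and the Poincaré inequality

  toℕ-mod : ∀ m d → toℕ (m ℕ.mod suc d) ≡ m % suc d
  toℕ-mod m d = Fin.toℕ-fromℕ< (ℕ.m%n<n m (suc d))

  mod-cong : ∀ a b d → a % suc d ≡ b % suc d → a ℕ.mod suc d ≡ b ℕ.mod suc d
  mod-cong a b d eq = Fin.toℕ-injective (trans (toℕ-mod a d) (trans eq (sym (toℕ-mod b d))))

  [m+n%o]%o≡[m+n]%o : ∀ m n d → (m ℕ.+ n % suc d) % suc d ≡ (m ℕ.+ n) % suc d
  [m+n%o]%o≡[m+n]%o m n d = begin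
    (m ℕ.+ n % suc d) % suc d                     ≡⟨ ℕ.%-distribˡ-+ m (n % suc d) (suc d) ⟩
    (m % suc d ℕ.+ n % suc d % suc d) % suc d
      ≡⟨ cong (λ x → (m % suc d ℕ.+ x) % suc d) (ℕ.m%n%n≡m%n n (suc d)) ⟩
    (m % suc d ℕ.+ n % suc d) % suc d             ≡⟨ ℕ.%-distribˡ-+ m n (suc d) ⟨
    (m ℕ.+ n) % suc d ∎
    where open ≡-Reasoning

  next-mod : ∀ d m → suc (toℕ (m ℕ.mod suc d)) ℕ.mod suc d ≡ suc m ℕ.mod suc d
  next-mod d m = mod-cong (suc (toℕ (m ℕ.mod suc d))) (suc m) d
     (trans (cong (λ x → suc x % suc d) (toℕ-mod m d)) ([m+n%o]%o≡[m+n]%o 1 m d))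

  -- `IsCycle` reaches the predecessor by adding `d`, which is -1 modulo `suc d`.
  prev-mod : ∀ d m → (toℕ (suc m ℕ.mod suc d) ℕ.+ d) ℕ.mod suc d ≡ m ℕ.mod suc d
  prev-mod d m = mod-cong (toℕ (suc m ℕ.mod suc d) ℕ.+ d) m d (begin
    (toℕ (suc m ℕ.mod suc d) ℕ.+ d) % suc d   ≡⟨ cong (λ x → (x ℕ.+ d) % suc d) (toℕ-mod (suc m) d) ⟩
    (suc m % suc d ℕ.+ d) % suc d             ≡⟨ cong (_% suc d) (ℕ.+-comm (suc m % suc d) d) ⟩
    (d ℕ.+ suc m % suc d) % suc d             ≡⟨ [m+n%o]%o≡[m+n]%o d (suc m) d ⟩
    (d ℕ.+ suc m) % suc d                     ≡⟨ cong (_% suc d) (trans (ℕ.+-suc d m) (ℕ.+-comm (suc d) m)) ⟩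
    (m ℕ.+ suc d) % suc d                     ≡⟨ ℕ.[m+n]%n≡m%n m (suc d) ⟩
    m % suc d ∎)
    where open ≡-Reasoning

  -- The residues of m + 2 and m are the two neighbours of that of m + 1, so the left-hand side is a
  -- single term of the energy. The labelling only affects the sign inside the square.
  two-step : ∀ {d} (C : Graph (suc d) 2) → IsCycle C → ∀ (g : Fin (suc d) → ℚ) m →
             (g (suc (suc m) ℕ.mod suc d) - g (m ℕ.mod suc d)) *
             (g (suc (suc m) ℕ.mod suc d) - g (m ℕ.mod suc d)) ≤ energy C g
  two-step {d} C isCycle g m = ≤-trans (≤-reflexive eq)
    (term≤sum (λ k → (x k - y k) * (x k - y k)) (λ k → 0≤p² (x k - y k)) k₁)
    where
    open +-*-Solver
    k₁ = suc m ℕ.mod suc d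
    x y : Fin (suc d) → ℚ
    x k = g (neighbour C k Fin.zero)
    y k = g (neighbour C k (Fin.suc Fin.zero))
    swap : ∀ p q → (p - q) * (p - q) ≡ (q - p) * (q - p)
    swap = solve 2 (λ p q → (p :- q) :* (p :- q) := (q :- p) :* (q :- p)) refl
    square : ℚ → ℚ
    square p = p * p
    eq : square (g (suc (suc m) ℕ.mod suc d) - g (m ℕ.mod suc d)) ≡ square (x k₁ - y k₁)
    eq with isCycle k₁
    ... | inj₁ (x≡next , y≡prev) =
      cong square (cong₂ (λ a b → g a - g b) (sym (trans x≡next (next-mod d (suc m))))
                                             (sym (trans y≡prev (prev-mod d m))))
    ... | inj₂ (x≡prev , y≡next) = trans
      (cong square (cong₂ (λ a b → g a - g b) (sym (trans y≡next (next-mod d (suc m))))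
                                              (sym (trans x≡prev (prev-mod d m)))))
      (swap (y k₁) (x k₁))

  -- The recursion solved by `even-step`: each further double step costs one use of (p + q)² ≤ 2p² +
  -- 2q². In closed form this is 2^(t+1) - 2; a crude constant suffices, as it depends on D alone.
  growth : ℕ → ℚ
  growth zero    = 0ℚ
  growth (suc t) = (1ℚ + 1ℚ) * (1ℚ + growth t)

  growth-nonNeg : ∀ t → 0ℚ ≤ growth t
  growth-nonNeg zero    = ≤-refl
  growth-nonNeg (suc t) = 0≤p*q (nonNegative⁻¹ (1ℚ + 1ℚ)) (0≤p+q (nonNegative⁻¹ 1ℚ) (growth-nonNeg t))

  even-step : ∀ {d} (C : Graph (suc d) 2) → IsCycle C → ∀ (g : Fin (suc d) → ℚ) t →
              (g ((t ℕ.* 2) ℕ.mod suc d) - g Fin.zero) * (g ((t ℕ.* 2) ℕ.mod suc d) - g Fin.zero)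
                ≤ growth t * energy C g
  even-step C isCycle g zero = ≤-reflexive (lemma (g Fin.zero) (energy C g))
    where
    open +-*-Solver
    lemma : ∀ p e → (p - p) * (p - p) ≡ 0ℚ * e
    lemma = solve 2 (λ p e → (p :- p) :* (p :- p) := con 0ℚ :* e) refl
  even-step {d} C isCycle g (suc t) = begin
    (g₂ - g₀) * (g₂ - g₀)
      ≡⟨ cong (λ p → p * p) (lemma₁ g₂ g₁ g₀) ⟩
    ((g₂ - g₁) + (g₁ - g₀)) * ((g₂ - g₁) + (g₁ - g₀))
      ≤⟨ [p+q]²≤2p²+2q² (g₂ - g₁) (g₁ - g₀) ⟩
    (g₂ - g₁) * (g₂ - g₁) + (g₂ - g₁) * (g₂ - g₁) + ((g₁ - g₀) * (g₁ - g₀) + (g₁ - g₀) * (g₁ - g₀))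
      ≤⟨ +-mono-≤ (+-mono-≤ two two) (+-mono-≤ rec rec) ⟩
    energy C g + energy C g + (growth t * energy C g + growth t * energy C g)
      ≡⟨ lemma₂ (energy C g) (growth t) ⟩
    growth (suc t) * energy C g ∎
    where
    open ≤-Reasoning
    open +-*-Solver
    g₀ = g Fin.zero
    g₁ = g ((t ℕ.* 2) ℕ.mod suc d)
    g₂ = g ((suc t ℕ.* 2) ℕ.mod suc d)
    two = two-step C isCycle g (t ℕ.* 2)
    rec = even-step C isCycle g t
    lemma₁ : ∀ a b c → a - c ≡ (a - b) + (b - c)
    lemma₁ = solve 3 (λ a b c → a :- c := (a :- b) :+ (b :- c)) refl
    lemma₂ : ∀ e k → e + e + (k * e + k * e) ≡ (1ℚ + 1ℚ) * (1ℚ + k) * e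
    lemma₂ = solve 2 (λ e k → e :+ e :+ (k :* e :+ k :* e) := (con 1ℚ :+ con 1ℚ) :* (con 1ℚ :+ k) :* e) refl

  -- For odd D, suc (D / 2) is the inverse of 2 modulo D.
  halve : ∀ {d} → suc d % 2 ≡ 1 → (k : Fin (suc d)) →
          (toℕ k ℕ.* suc (suc d / 2) ℕ.* 2) ℕ.mod suc d ≡ k
  halve {d} odd k = Fin.toℕ-injective (begin
    toℕ ((toℕ k ℕ.* suc p ℕ.* 2) ℕ.mod suc d)   ≡⟨ toℕ-mod (toℕ k ℕ.* suc p ℕ.* 2) d ⟩
    (toℕ k ℕ.* suc p ℕ.* 2) % suc d             ≡⟨ cong (_% suc d) (lemma (toℕ k) p) ⟩
    (toℕ k ℕ.+ toℕ k ℕ.* (1 ℕ.+ p ℕ.* 2)) % suc d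
      ≡⟨ cong (λ n → (toℕ k ℕ.+ toℕ k ℕ.* n) % suc d) 1+2p≡D ⟩
    (toℕ k ℕ.+ toℕ k ℕ.* suc d) % suc d         ≡⟨ ℕ.[m+kn]%n≡m%n (toℕ k) (toℕ k) (suc d) ⟩
    toℕ k % suc d                               ≡⟨ ℕ.m<n⇒m%n≡m (Fin.toℕ<n k) ⟩
    toℕ k ∎)
    where
    open ≡-Reasoning
    open ℕ-Solver.+-*-Solver
    p = suc d / 2
    1+2p≡D : 1 ℕ.+ p ℕ.* 2 ≡ suc d
    1+2p≡D = trans (cong (ℕ._+ p ℕ.* 2) (sym odd)) (sym (ℕ.m≡m%n+[m/n]*n (suc d) 2))
    lemma : ∀ k p → k ℕ.* suc p ℕ.* 2 ≡ k ℕ.+ k ℕ.* (1 ℕ.+ p ℕ.* 2)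
    lemma = solve 2 (λ k p → k :* (con 1 :+ p) :* con 2 := k :+ k :* (con 1 :+ p :* con 2)) refl

  -- The Poincaré constant. Vertex `k` is reached from vertex 0 by `toℕ k * suc (suc d / 2)` double
  -- steps, as `halve` shows. The leading 1 keeps the constant at least 1, so that it can be
  -- inverted and the resulting gap is at most 1.
  spread : ℕ → ℚ
  spread d = 1ℚ + ∑[ k < suc d ] growth (toℕ k ℕ.* suc (suc d / 2))

  1≤spread : ∀ d → 1ℚ ≤ spread d
  1≤spread d = ≤-trans (≤-reflexive (sym (+-identityʳ 1ℚ)))
    (+-monoʳ-≤ 1ℚ (sum-nonNeg {suc d} λ k → growth-nonNeg (toℕ k ℕ.* suc (suc d / 2))))

  -- The energy controls only differences between vertices two steps apart. As D is odd, double
  -- steps from vertex 0 reach every vertex, so all differences to `g Fin.zero` are controlled; on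
  -- an even cycle the two parity classes would stay apart.
  poincaré : ∀ {d} → suc d % 2 ≡ 1 → (C : Graph (suc d) 2) → IsCycle C →
             ∀ g → deviation g ≤ spread d * energy C g
  poincaré {d} odd C isCycle g = begin
    deviation g
      ≤⟨ deviation≤normSq-shift g (g Fin.zero) ⟩
    normSq (λ k → g k - g Fin.zero)
      ≤⟨ sum-mono-≤ (λ k → subst (λ j → (g j - g Fin.zero) * (g j - g Fin.zero) ≤ growth (t k) * energy C g)
                                 (halve odd k) (even-step C isCycle g (t k))) ⟩
    ∑[ k < suc d ] (growth (t k) * energy C g)
      ≡⟨ *-distribʳ-sum (energy C g) (growth ∘ t) ⟨
    sum (growth ∘ t) * energy C g
      ≤⟨ *-monoʳ-≤-nonNeg (energy C g) {{ℚ.nonNegative (energy-nonNeg C g)}}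
           (≤-trans (≤-reflexive (sym (+-identityˡ (sum (growth ∘ t))))) (+-monoˡ-≤ (sum (growth ∘ t)) (nonNegative⁻¹ 1ℚ))) ⟩
    spread d * energy C g ∎
    where
    open ≤-Reasoning
    t : Fin (suc d) → ℕ
    t k = toℕ k ℕ.* suc (suc d / 2)

  -- The walk loses exactly a quarter of the energy, and the energy is at least the deviation
  -- divided by `spread d`. Hence the choice of η as 1 / (4 `spread d`).
  spread*η≡¼⇒gap : ∀ {d} → suc d % 2 ≡ 1 → ∀ η → 0ℚ ≤ η → spread d * η ≡ ½ * ½ →
                   (C : Graph (suc d) 2) → IsCycle C →
                   ∀ g → normSq (walk C g) ≤ normSq g - η * deviation g
  spread*η≡¼⇒gap {d} odd η 0≤η Lη≡¼ C isCycle g = begin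
    normSq (walk C g)
      ≡⟨ lemma₂ (normSq (walk C g)) (½ * ½ * energy C g) ⟩
    normSq (walk C g) + ½ * ½ * energy C g - ½ * ½ * energy C g
      ≡⟨ cong (_- ½ * ½ * energy C g) (walk-energy C g) ⟩
    normSq g - ½ * ½ * energy C g
      ≡⟨ cong (λ x → normSq g - x * energy C g) Lη≡¼ ⟨
    normSq g - spread d * η * energy C g
      ≡⟨ cong (λ x → normSq g - x) (lemma₁ η (spread d) (energy C g)) ⟨
    normSq g - η * (spread d * energy C g)
      ≤⟨ +-monoʳ-≤ (normSq g) (neg-antimono-≤ (*-monoˡ-≤-nonNeg η {{ℚ.nonNegative 0≤η}}
           (poincaré odd C isCycle g))) ⟩
    normSq g - η * deviation g ∎
    where
    open ≤-Reasoning
    open +-*-Solver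
    lemma₁ : ∀ η l e → η * (l * e) ≡ l * η * e
    lemma₁ = solve 3 (λ η l e → η :* (l :* e) := l :* η :* e) refl
    lemma₂ : ∀ w e → w ≡ w + e - e
    lemma₂ = solve 2 (λ w e → w := w :+ e :- e) refl

  spread*η≡¼⇒η≤1 : ∀ d η → 0ℚ ≤ η → spread d * η ≡ ½ * ½ → η ≤ 1ℚ
  spread*η≡¼⇒η≤1 d η 0≤η Lη≡¼ = begin
    η              ≡⟨ *-identityˡ η ⟨
    1ℚ * η         ≤⟨ *-monoʳ-≤-nonNeg η {{ℚ.nonNegative 0≤η}} (1≤spread d) ⟩
    spread d * η   ≡⟨ Lη≡¼ ⟩
    ½ * ½          ≤⟨ from-yes (½ * ½ ≤? 1ℚ) ⟩
    1ℚ             ∎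
    where open ≤-Reasoning

  cycle-gap : ∀ d → suc d % 2 ≡ 1 → ∃ λ η → 0ℚ < η × η ≤ 1ℚ ×
              (∀ (C : Graph (suc d) 2) → IsCycle C →
               ∀ g → normSq (walk C g) ≤ normSq g - η * deviation g)
  cycle-gap d odd =
    let η , 0<η , Lη≡¼ = rescale (spread d) (½ * ½) (<-≤-trans (positive⁻¹ 1ℚ) (1≤spread d)) (half>0 (positive⁻¹ ½))
    in η , 0<η , spread*η≡¼⇒η≤1 d η (<⇒≤ 0<η) Lη≡¼ , spread*η≡¼⇒gap odd η (<⇒≤ 0<η) Lη≡¼

-- The estimate for B A B on rational vectors

module ZigZagEstimate where

  open import Data.Rational using (_*_)
  open FiniteSums
  open OddCycle

  ¼ : ℚ
  ¼ = ½ * ½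

  -- A, b, X and Y stand for the squared norms of the vectors called a (spread over
  -- the clouds), g, γ and the cloud means of γ in the header, Q for that of M a, Z
  -- for that of the part of the cloud means of γ coming from g, and S for the error
  -- term.  The proof exhibits the right-hand side minus the left-hand side as a
  -- nonnegative combination of the slacks of the hypotheses.
  combination : ∀ t η A b S Q X Y Z R →
    0ℚ ≤ t → t ≤ 1ℚ → 0ℚ ≤ η → η ≤ 1ℚ → 0ℚ ≤ A → 0ℚ ≤ b → 0ℚ ≤ S →
    R ≤ X - η * (X - Y) → 0ℚ ≤ X - Y → X ≤ A + b - η * b →
    t * Y ≤ t * (1ℚ + t) * Q + (1ℚ + t) * Z → Q ≤ (1ℚ - (t + t)) * A + S → Z ≤ b →
    R ≤ (1ℚ - ¼ * η * t * t) * (A + b) + S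
  combination t η A b S Q X Y Z R 0≤t t≤1 0≤η η≤1 0≤A 0≤b 0≤S h₁ h₂ h₃ h₄ h₅ h₆ =
    0≤q-p⇒p≤q (≤-trans
      (0≤p+q (0≤p+q (0≤p+q (0≤p+q (0≤p+q (0≤p+q (0≤p+q (0≤p+q
        (p≤q⇒0≤q-p h₁)
        -- The weights come from eliminating variables: with weight η/4 on `h₄`, Y cancels if `h₂`
        -- has weight η(1 - t/4), X if `h₃` has weight 1 - ηt/4, and Q and Z by the weights of `h₅`
        -- and `h₆`. The first two are written as (1 - t) + 3t/4 and (1 - ηt) + 3ηt/4 to make them
        -- visibly nonnegative.
        (0≤p*q (0≤p*q 0≤η (0≤p+q 0≤u (0≤p*q 0≤¾ 0≤t))) h₂))
        (0≤p*q (0≤p+q 0≤w (0≤p*q 0≤¾ 0≤ηt)) (p≤q⇒0≤q-p h₃)))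
        (0≤p*q (0≤p*q 0≤¼ 0≤η) (p≤q⇒0≤q-p h₄)))
        (0≤p*q (0≤p*q (0≤p*q 0≤¼ 0≤ηt) 0≤1+t) (p≤q⇒0≤q-p h₅)))
        (0≤p*q (0≤p*q (0≤p*q 0≤¼ 0≤η) 0≤1+t) (p≤q⇒0≤q-p h₆)))
        (0≤p*q (0≤p*q (0≤p*q (0≤p*q (nonNegative⁻¹ ½) 0≤ηt) 0≤t) 0≤t) 0≤A))
        (0≤p*q (0≤p*q (0≤p*q 0≤¼ 0≤η) (0≤p+q (0≤p+q (0≤p*q 0≤u 0≤1+t) 0≤w) 0≤1)) 0≤b))
        (0≤p*q (0≤p+q 0≤w (0≤p*q (0≤p*q 0≤¼ 0≤ηt) (0≤p+q (0≤p+q 0≤1 0≤1) 0≤u))) 0≤S))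
      (≤-reflexive (lemma t η A b S Q X Y Z R)))
    where
    open +-*-Solver
    0≤1 : 0ℚ ≤ 1ℚ
    0≤1 = nonNegative⁻¹ 1ℚ
    0≤¼ : 0ℚ ≤ ¼
    0≤¼ = nonNegative⁻¹ ¼
    0≤¾ : 0ℚ ≤ ½ + ¼
    0≤¾ = nonNegative⁻¹ (½ + ¼)
    0≤ηt = 0≤p*q 0≤η 0≤t
    0≤1+t = 0≤p+q 0≤1 0≤t
    0≤u = p≤q⇒0≤q-p t≤1
    0≤w : 0ℚ ≤ 1ℚ - η * t
    0≤w = p≤q⇒0≤q-p (*-mono-≤-nonNeg {η} {1ℚ} {t} {1ℚ} 0≤t 0≤1 η≤1 t≤1)
    lemma : ∀ t η A b S Q X Y Z R →
      X - η * (X - Y) - R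
      + η * ((1ℚ - t) + (½ + ¼) * t) * (X - Y)
      + ((1ℚ - η * t) + (½ + ¼) * (η * t)) * (A + b - η * b - X)
      + ¼ * η * (t * (1ℚ + t) * Q + (1ℚ + t) * Z - t * Y)
      + ¼ * (η * t) * (1ℚ + t) * ((1ℚ - (t + t)) * A + S - Q)
      + ¼ * η * (1ℚ + t) * (b - Z)
      + ½ * (η * t) * t * t * A
      + ¼ * η * ((1ℚ - t) * (1ℚ + t) + (1ℚ - η * t) + 1ℚ) * b
      + ((1ℚ - η * t) + ¼ * (η * t) * (1ℚ + 1ℚ + (1ℚ - t))) * S
      ≡ (1ℚ - ¼ * η * t * t) * (A + b) + S - R
    lemma = solve 10 (λ t η A b S Q X Y Z R →
      let one = con 1ℚ ; q = con ¼ ; h = con ½ in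
      X :- η :* (X :- Y) :- R
      :+ η :* ((one :- t) :+ (h :+ q) :* t) :* (X :- Y)
      :+ ((one :- η :* t) :+ (h :+ q) :* (η :* t)) :* (A :+ b :- η :* b :- X)
      :+ q :* η :* (t :* (one :+ t) :* Q :+ (one :+ t) :* Z :- t :* Y)
      :+ q :* (η :* t) :* (one :+ t) :* ((one :- (t :+ t)) :* A :+ S :- Q)
      :+ q :* η :* (one :+ t) :* (b :- Z)
      :+ h :* (η :* t) :* t :* t :* A
      :+ q :* η :* ((one :- t) :* (one :+ t) :+ (one :- η :* t) :+ one) :* b
      :+ ((one :- η :* t) :+ q :* (η :* t) :* (one :+ one :+ (one :- t))) :* S
      := (one :- q :* η :* t :* t) :* (A :+ b) :+ S :- R) refl

  -- The transition operator of a graph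

  transition : ∀ {N D} → Graph N D → (Fin N → ℚ) → Fin N → ℚ
  transition G a u = mean λ i → a (neighbour G u i)

  -- The bound q on the square of the second eigenvalue, for rational vectors.
  Contracts : ∀ {N D} → Graph N D → ℚ → Set
  Contracts G q = ∀ a → sum a ≡ 0ℚ → normSq (transition G a) ≤ q * normSq a

  sum-distrib-- : ∀ {n} (f g : Fin n → ℚ) → ∑[ i < n ] (f i - g i) ≡ sum f - sum g
  sum-distrib-- {zero}  f g = refl
  sum-distrib-- {suc n} f g = trans
    (cong (f Fin.zero - g Fin.zero +_) (sum-distrib-- (f ∘ Fin.suc) (g ∘ Fin.suc)))
    (lemma (f Fin.zero) (g Fin.zero) (sum (f ∘ Fin.suc)) (sum (g ∘ Fin.suc)))
    where
    open +-*-Solver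
    lemma : ∀ a b c d → a - b + (c - d) ≡ a + c - (b + d)
    lemma = solve 4 (λ a b c d → a :- b :+ (c :- d) := a :+ c :- (b :+ d)) refl

  mean-const : ∀ d c → mean {suc d} (λ _ → c) ≡ c
  mean-const d c = begin
    recip d * sum {suc d} (λ _ → c)   ≡⟨ cong (recip d *_) (sum-const {suc d} c) ⟩
    recip d * (card (suc d) * c)      ≡⟨ lemma (recip d) (card (suc d)) c ⟩
    card (suc d) * recip d * c        ≡⟨ cong (_* c) (card*recip d) ⟩
    1ℚ * c                            ≡⟨ *-identityˡ c ⟩
    c                                 ∎
    where
    open ≡-Reasoning
    open +-*-Solver
    lemma : ∀ r n c → r * (n * c) ≡ n * r * c
    lemma = solve 3 (λ r n c → r :* (n :* c) := n :* r :* c) refl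

  mean-cong : ∀ {d} {f g : Fin (suc d) → ℚ} → (∀ i → f i ≡ g i) → mean f ≡ mean g
  mean-cong {d} f≡g = cong (recip d *_) (sum-cong-≗ f≡g)

  mean-distrib-- : ∀ {d} (f g : Fin (suc d) → ℚ) → mean (λ i → f i - g i) ≡ mean f - mean g
  mean-distrib-- {d} f g = trans (cong (recip d *_) (sum-distrib-- f g))
                                 (lemma (recip d) (sum f) (sum g))
    where
    open +-*-Solver
    lemma : ∀ r a b → r * (a - b) ≡ r * a - r * b
    lemma = solve 3 (λ r a b → r :* (a :- b) := r :* a :- r :* b) refl

  mean-distrib-+ : ∀ {d} (f g : Fin (suc d) → ℚ) → mean (λ i → f i + g i) ≡ mean f + mean g
  mean-distrib-+ {d} f g = trans (cong (recip d *_) (∑-distrib-+ f g))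
                                 (*-distribˡ-+ (recip d) (sum f) (sum g))

  recip-nonNeg : ∀ d → 0ℚ ≤ recip d
  recip-nonNeg d = nonNegative⁻¹ (recip d) {{normalize-nonNeg 1 (suc d)}}

  recip≤1 : ∀ d → recip d ≤ 1ℚ
  recip≤1 d = begin
    recip d                   ≡⟨ *-identityˡ (recip d) ⟨
    1ℚ * recip d              ≤⟨ *-monoʳ-≤-nonNeg (recip d) {{ℚ.nonNegative (recip-nonNeg d)}}
                                   (term≤sum {suc d} (λ _ → 1ℚ) (λ _ → nonNegative⁻¹ 1ℚ) Fin.zero) ⟩
    card (suc d) * recip d    ≡⟨ card*recip d ⟩
    1ℚ                        ∎
    where open ≤-Reasoning

  sum-transition : ∀ {N d} (G : Graph N (suc d)) a → sum (transition G a) ≡ sum a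
  sum-transition {N} {d} G a = begin
    ∑[ u < N ] (recip d * ∑[ i < suc d ] a (neighbour G u i))
      ≡⟨ *-distribˡ-sum (recip d) (λ u → ∑[ i < suc d ] a (neighbour G u i)) ⟨
    recip d * (∑[ u < N ] ∑[ i < suc d ] a (neighbour G u i))
      ≡⟨ cong (recip d *_) (∑∑-involution (rot G) (rot-involutive G) (a ∘ proj₁)) ⟩
    recip d * (∑[ u < N ] ∑[ i < suc d ] a u)
      ≡⟨ *-distribˡ-sum (recip d) (λ u → ∑[ i < suc d ] a u) ⟩
    ∑[ u < N ] mean {suc d} (λ _ → a u)
      ≡⟨ sum-cong-≗ (λ u → mean-const d (a u)) ⟩
    sum a ∎
    where open ≡-Reasoning

  normSq-cong : ∀ {n} {f g : Fin n → ℚ} → (∀ i → f i ≡ g i) → normSq f ≡ normSq g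
  normSq-cong f≡g = sum-cong-≗ λ i → cong₂ _*_ (f≡g i) (f≡g i)

  -- The transition operator preserves sums and fixes constants, so the part of mean zero, to which
  -- `contracts` applies, and the constant part stay orthogonal. The constant part contributes (sum
  -- a)² / N, which is at most (sum a)².
  normSq-transition : ∀ {N d} (G : Graph N (suc d)) q → 0ℚ ≤ q → Contracts G q →
    ∀ a → normSq (transition G a) ≤ q * normSq a + sum a * sum a
  normSq-transition {zero} G q 0≤q contracts a = ≤-reflexive (lemma q)
    where
    open +-*-Solver
    lemma : ∀ q → 0ℚ ≡ q * 0ℚ + 0ℚ * 0ℚ
    lemma = solve 1 (λ q → con 0ℚ := q :* con 0ℚ :+ con 0ℚ :* con 0ℚ) refl
  normSq-transition {suc n} {d} G q 0≤q contracts a = begin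
    normSq T
      ≡⟨ lemma₁ (normSq T) (card (suc n) * (mean T * mean T)) ⟩
    deviation T + card (suc n) * (mean T * mean T)
      ≡⟨ cong₂ _+_ (deviation≡ T) (*-assoc (card (suc n)) (mean T) (mean T)) ⟨
    normSq (λ u → T u - mean T) + card (suc n) * mean T * mean T
      ≡⟨ cong₂ _+_ (normSq-cong shift) (cong₂ _*_ (card*mean T) refl) ⟩
    normSq (transition G a₀) + sum T * (recip n * sum T)
      ≡⟨ cong (λ s → normSq (transition G a₀) + s * (recip n * s)) (sum-transition G a) ⟩
    normSq (transition G a₀) + sum a * (recip n * sum a)
      ≤⟨ +-monoˡ-≤ (sum a * (recip n * sum a)) (contracts a₀ sum-a₀) ⟩
    q * normSq a₀ + sum a * (recip n * sum a)
      ≡⟨ cong (λ x → q * x + sum a * (recip n * sum a)) (deviation≡ a) ⟩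
    q * deviation a + sum a * (recip n * sum a)
      ≤⟨ +-monoˡ-≤ (sum a * (recip n * sum a)) (*-monoˡ-≤-nonNeg q {{ℚ.nonNegative 0≤q}} deviation≤normSq) ⟩
    q * normSq a + sum a * (recip n * sum a)
      ≡⟨ cong (q * normSq a +_) (lemma₂ (sum a) (recip n)) ⟩
    q * normSq a + recip n * (sum a * sum a)
      ≤⟨ +-monoʳ-≤ (q * normSq a) (*-monoʳ-≤-nonNeg (sum a * sum a) {{ℚ.nonNegative (0≤p² (sum a))}} (recip≤1 n)) ⟩
    q * normSq a + 1ℚ * (sum a * sum a)
      ≡⟨ cong (q * normSq a +_) (*-identityˡ (sum a * sum a)) ⟩
    q * normSq a + sum a * sum a ∎
    where
    open ≤-Reasoning
    open +-*-Solver
    T a₀ : Fin (suc n) → ℚ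
    T = transition G a
    a₀ u = a u - mean a
    lemma₁ : ∀ x y → x ≡ x - y + y
    lemma₁ = solve 2 (λ x y → x := x :- y :+ y) refl
    lemma₂ : ∀ s r → s * (r * s) ≡ r * (s * s)
    lemma₂ = solve 2 (λ s r → s :* (r :* s) := r :* (s :* s)) refl
    shift : ∀ u → T u - mean T ≡ transition G a₀ u
    shift u = trans (cong (λ s → T u - recip n * s) (sum-transition G a))
      (sym (trans (mean-distrib-- (λ i → a (neighbour G u i)) (λ _ → mean a))
                  (cong (λ c → T u - c) (mean-const d (mean a)))))
    sum-a₀ : sum a₀ ≡ 0ℚ
    sum-a₀ = trans (sum-distrib-- a (λ _ → mean a))
      (trans (cong (λ s → sum a - s) (trans (sum-const {suc n} (mean a)) (card*mean a)))
             (+-inverseʳ (sum a)))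
    deviation≤normSq : deviation a ≤ normSq a
    deviation≤normSq = ≤-trans
      (+-monoʳ-≤ (normSq a) (neg-antimono-≤ (0≤p*q (card-nonNeg (suc n)) (0≤p² (mean a)))))
      (≤-reflexive (+-identityʳ (normSq a)))

  -- Vectors on the clouds, curried as functions of the cloud and the position in it

  normSq₂ : ∀ {m n} → (Fin m → Fin n → ℚ) → ℚ
  normSq₂ f = sum λ v → normSq (f v)

  -- The squared norm of the vector of cloud means spread over the clouds: each mean is counted once
  -- per vertex of its cloud.
  meanNormSq : ∀ {m d} → (Fin m → Fin (suc d) → ℚ) → ℚ
  meanNormSq {m} {d} f = ∑[ v < m ] (card (suc d) * (mean (f v) * mean (f v)))

  totalDeviation : ∀ {m d} → (Fin m → Fin (suc d) → ℚ) → ℚ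
  totalDeviation f = sum λ v → deviation (f v)

  totalDeviation-nonNeg : ∀ {m d} (f : Fin m → Fin (suc d) → ℚ) → 0ℚ ≤ totalDeviation f
  totalDeviation-nonNeg f = sum-nonNeg λ v → deviation-nonNeg (f v)

  totalDeviation≡ : ∀ {m d} (f : Fin m → Fin (suc d) → ℚ) → totalDeviation f ≡ normSq₂ f - meanNormSq f
  totalDeviation≡ {m} {d} f = sum-distrib-- (λ v → normSq (f v))
                                            (λ v → card (suc d) * (mean (f v) * mean (f v)))

  meanNormSq≤normSq₂ : ∀ {m d} (f : Fin m → Fin (suc d) → ℚ) → meanNormSq f ≤ normSq₂ f
  meanNormSq≤normSq₂ f =
    0≤q-p⇒p≤q (≤-trans (totalDeviation-nonNeg f) (≤-reflexive (totalDeviation≡ f)))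

  walk-meanNormSq : ∀ {m d} (C : Graph (suc d) 2) η →
    (∀ g → normSq (walk C g) ≤ normSq g - η * deviation g) →
    (f : Fin m → Fin (suc d) → ℚ) →
    normSq₂ (λ v → walk C (f v)) ≤ normSq₂ f - η * totalDeviation f
  walk-meanNormSq {m} C η gap f = ≤-trans (sum-mono-≤ λ v → gap (f v)) (≤-reflexive (trans
    (sum-distrib-- (λ v → normSq (f v)) (λ v → η * deviation (f v)))
    (cong (λ x → normSq₂ f - x) (sym (*-distribˡ-sum η (λ v → deviation (f v)))))))

  normSq-walk≤ : ∀ {n} (C : Graph n 2) g → normSq (walk C g) ≤ normSq g
  normSq-walk≤ C g = ≤-trans (≤-reflexive (sym (+-identityʳ (normSq (walk C g)))))
    (≤-trans (+-monoʳ-≤ (normSq (walk C g)) (0≤p*q (nonNegative⁻¹ ¼) (energy-nonNeg C g)))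
             (≤-reflexive (walk-energy C g)))

  -- The large-graph step of the zig-zag product.
  cross : ∀ {N D} → Graph N D → (Fin N → Fin D → ℚ) → Fin N → Fin D → ℚ
  cross G f v k = uncurry f (rot G (v , k))

  normSq₂-cross : ∀ {N D} (G : Graph N D) f → normSq₂ (cross G f) ≡ normSq₂ f
  normSq₂-cross G f = ∑∑-involution (rot G) (rot-involutive G) (λ e → uncurry f e * uncurry f e)

  -- Pointwise this is (x + y)² ≤ (1 + t) x² + (1 + 1/t) y², multiplied by t to avoid the division;
  -- the slack is (t x - y)². The factor 1 + t on the main term is affordable because (1 + t)(1 -
  -- 2t) is still below 1 for positive t.
  meanNormSq-+ : ∀ {N d} (f : Fin N → Fin (suc d) → ℚ) (x y : Fin N → ℚ) → (∀ v → mean (f v) ≡ x v + y v) →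
    ∀ t → t * meanNormSq f ≤ t * (1ℚ + t) * (card (suc d) * normSq x)
                             + (1ℚ + t) * ∑[ v < N ] (card (suc d) * (y v * y v))
  meanNormSq-+ {N} {d} f x y mean≡x+y t = begin
    t * meanNormSq f
      ≡⟨ *-distribˡ-sum t (λ v → n * (mean (f v) * mean (f v))) ⟩
    ∑[ v < N ] (t * (n * (mean (f v) * mean (f v))))
      ≤⟨ sum-mono-≤ pointwise ⟩
    ∑[ v < N ] (t * (1ℚ + t) * (n * (x v * x v)) + (1ℚ + t) * (n * (y v * y v)))
      ≡⟨ ∑-distrib-+ (λ v → t * (1ℚ + t) * (n * (x v * x v))) (λ v → (1ℚ + t) * (n * (y v * y v))) ⟩
    ∑[ v < N ] (t * (1ℚ + t) * (n * (x v * x v))) + ∑[ v < N ] ((1ℚ + t) * (n * (y v * y v)))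
      ≡⟨ cong₂ _+_ (*-distribˡ-sum (t * (1ℚ + t)) (λ v → n * (x v * x v)))
                   (*-distribˡ-sum (1ℚ + t) (λ v → n * (y v * y v))) ⟨
    t * (1ℚ + t) * (∑[ v < N ] (n * (x v * x v))) + (1ℚ + t) * ∑[ v < N ] (n * (y v * y v))
      ≡⟨ cong (λ s → t * (1ℚ + t) * s + (1ℚ + t) * ∑[ v < N ] (n * (y v * y v)))
              (*-distribˡ-sum n (λ v → x v * x v)) ⟨
    t * (1ℚ + t) * (n * normSq x) + (1ℚ + t) * ∑[ v < N ] (n * (y v * y v)) ∎
    where
    open ≤-Reasoning
    open +-*-Solver
    n = card (suc d)
    lemma : ∀ t n x y → n * ((t * x - y) * (t * x - y)) ≡
            t * (1ℚ + t) * (n * (x * x)) + (1ℚ + t) * (n * (y * y)) - t * (n * ((x + y) * (x + y)))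
    lemma = solve 4 (λ t n x y → n :* ((t :* x :- y) :* (t :* x :- y)) :=
      t :* (con 1ℚ :+ t) :* (n :* (x :* x)) :+ (con 1ℚ :+ t) :* (n :* (y :* y))
      :- t :* (n :* ((x :+ y) :* (x :+ y)))) refl
    pointwise : ∀ v → t * (n * (mean (f v) * mean (f v))) ≤
                t * (1ℚ + t) * (n * (x v * x v)) + (1ℚ + t) * (n * (y v * y v))
    pointwise v = ≤-trans (≤-reflexive (cong (λ m → t * (n * (m * m))) (mean≡x+y v)))
      (0≤q-p⇒p≤q (≤-trans (0≤p*q (card-nonNeg (suc d)) (0≤p² (t * x v - y v)))
                          (≤-reflexive (lemma t n (x v) (y v)))))

  walk-shift : ∀ {n} (C : Graph n 2) g c k → walk C g k ≡ c + walk C (λ j → g j - c) k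
  walk-shift C g c k = lemma c (g (neighbour C k Fin.zero)) (g (neighbour C k (Fin.suc Fin.zero)))
    where
    open +-*-Solver
    lemma : ∀ c x y → ½ * (x + y) ≡ c + ½ * ((x - c) + (y - c))
    lemma = solve 3 (λ c x y → con ½ :* (x :+ y) := c :+ con ½ :* ((x :- c) :+ (y :- c))) refl

  zigzag : ∀ {N D} → Graph N D → Graph D 2 → (Fin N → Fin D → ℚ) → Fin N → Fin D → ℚ
  zigzag G C f v = walk C (cross G (λ w → walk C (f w)) v)

  mean-part : ∀ {N d} (f : Fin N → Fin (suc d) → ℚ) →
    card (suc d) * (sum (λ v → mean (f v)) * sum (λ v → mean (f v)))
      ≤ (∑[ v < N ] sum (f v)) * (∑[ v < N ] sum (f v))
  mean-part {N} {d} f = begin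
    n * (sum (λ v → mean (f v)) * sum (λ v → mean (f v)))
      ≡⟨ cong (λ x → n * (x * x)) (*-distribˡ-sum (recip d) (λ v → sum (f v))) ⟨
    n * (recip d * s * (recip d * s))
      ≡⟨ lemma n (recip d) s ⟩
    n * recip d * (recip d * (s * s))
      ≡⟨ cong (_* (recip d * (s * s))) (card*recip d) ⟩
    1ℚ * (recip d * (s * s))
      ≡⟨ *-identityˡ (recip d * (s * s)) ⟩
    recip d * (s * s)
      ≤⟨ *-monoʳ-≤-nonNeg (s * s) {{ℚ.nonNegative (0≤p² s)}} (recip≤1 d) ⟩
    1ℚ * (s * s)
      ≡⟨ *-identityˡ (s * s) ⟩
    s * s ∎
    where
    open ≤-Reasoning
    open +-*-Solver
    n = card (suc d)
    s = ∑[ v < N ] sum (f v)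
    lemma : ∀ n r s → n * (r * s * (r * s)) ≡ n * r * (r * (s * s))
    lemma = solve 3 (λ n r s → n :* (r :* s :* (r :* s)) := n :* r :* (r :* (s :* s))) refl

  -- The estimate is `combination` with its hypotheses read off the two walks and the large graph:
  -- `h₃` is the loss in the first B, `h₁` the loss in the second, `h₅` the contraction by G of the
  -- cloud means, and `h₆` bounds what `g` adds to the cloud means of `γ`.
  zigzag-bound : ∀ {N d} (G : Graph N (suc d)) (C : Graph (suc d) 2) t η →
    0ℚ ≤ t → t + t ≤ 1ℚ → 0ℚ ≤ η → η ≤ 1ℚ →
    Contracts G (1ℚ - (t + t)) → (∀ g → normSq (walk C g) ≤ normSq g - η * deviation g) →
    ∀ f → normSq₂ (zigzag G C f) ≤ (1ℚ - ¼ * η * t * t) * normSq₂ f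
                                 + (∑[ v < N ] sum (f v)) * (∑[ v < N ] sum (f v))
  zigzag-bound {N} {d} G C t η 0≤t 2t≤1 0≤η η≤1 contracts gap f = begin
    normSq₂ (zigzag G C f)
      ≤⟨ combination t η (meanNormSq f) (totalDeviation f) S (n * normSq (transition G a)) (normSq₂ γ)
           (meanNormSq γ) (∑[ v < N ] (n * (mean (h v) * mean (h v)))) (normSq₂ (zigzag G C f))
           0≤t t≤1 0≤η η≤1 0≤A (totalDeviation-nonNeg f) 0≤S h₁ h₂ h₃
           (meanNormSq-+ γ (transition G a) (λ v → mean (h v)) mean-γ t) h₅ h₆ ⟩
    (1ℚ - ¼ * η * t * t) * (meanNormSq f + totalDeviation f) + S
      ≡⟨ cong (λ x → (1ℚ - ¼ * η * t * t) * x + S) (sym F≡A+b) ⟩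
    (1ℚ - ¼ * η * t * t) * normSq₂ f + S
      ≤⟨ +-monoʳ-≤ ((1ℚ - ¼ * η * t * t) * normSq₂ f) (mean-part f) ⟩
    (1ℚ - ¼ * η * t * t) * normSq₂ f + (∑[ v < N ] sum (f v)) * (∑[ v < N ] sum (f v)) ∎
    where
    open ≤-Reasoning
    open +-*-Solver using (solve; _:+_; _:*_; _:-_; _:=_)
    n = card (suc d)
    a : Fin N → ℚ
    a v = mean (f v)
    g γ h : Fin N → Fin (suc d) → ℚ
    g v k = f v k - a v
    γ = cross G (λ w → walk C (f w))
    h = cross G (λ w → walk C (g w))
    S = n * (sum a * sum a)
    0≤A : 0ℚ ≤ meanNormSq f
    0≤A = sum-nonNeg λ v → 0≤p*q (card-nonNeg (suc d)) (0≤p² (a v))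
    0≤S : 0ℚ ≤ S
    0≤S = 0≤p*q (card-nonNeg (suc d)) (0≤p² (sum a))
    t≤1 : t ≤ 1ℚ
    t≤1 = ≤-trans (≤-reflexive (sym (+-identityʳ t))) (≤-trans (+-monoʳ-≤ t 0≤t) 2t≤1)
    F≡A+b : normSq₂ f ≡ meanNormSq f + totalDeviation f
    F≡A+b = trans (lemma (normSq₂ f) (meanNormSq f)) (cong (meanNormSq f +_) (sym (totalDeviation≡ f)))
      where
      lemma : ∀ x y → x ≡ y + (x - y)
      lemma = solve 2 (λ x y → x := y :+ (x :- y)) refl
    h₁ : normSq₂ (zigzag G C f) ≤ normSq₂ γ - η * (normSq₂ γ - meanNormSq γ)
    h₁ = ≤-trans (walk-meanNormSq C η gap γ)
                 (≤-reflexive (cong (λ x → normSq₂ γ - η * x) (totalDeviation≡ γ)))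
    h₂ : 0ℚ ≤ normSq₂ γ - meanNormSq γ
    h₂ = p≤q⇒0≤q-p (meanNormSq≤normSq₂ γ)
    h₃ : normSq₂ γ ≤ meanNormSq f + totalDeviation f - η * totalDeviation f
    h₃ = ≤-trans (≤-reflexive (normSq₂-cross G (λ w → walk C (f w))))
      (≤-trans (walk-meanNormSq C η gap f)
               (≤-reflexive (cong (λ x → x - η * totalDeviation f) F≡A+b)))
    -- B fixes constants, so on each cloud `w` it turns `f w` into `a w` plus the walk of `g w`.
    -- Averaged over the edges at `v`, the first summand becomes `transition G a v`.
    mean-γ : ∀ v → mean (γ v) ≡ transition G a v + mean (h v)
    mean-γ v = trans (mean-cong λ k → let w , ℓ = rot G (v , k) in walk-shift C (f w) (a w) ℓ)
                     (mean-distrib-+ (λ k → a (neighbour G v k)) (h v))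
    h₅ : n * normSq (transition G a) ≤ (1ℚ - (t + t)) * meanNormSq f + S
    h₅ = begin
      n * normSq (transition G a)
        ≤⟨ *-monoˡ-≤-nonNeg n {{ℚ.nonNegative (card-nonNeg (suc d))}}
             (normSq-transition G (1ℚ - (t + t)) (p≤q⇒0≤q-p 2t≤1) contracts a) ⟩
      n * ((1ℚ - (t + t)) * normSq a + sum a * sum a)
        ≡⟨ lemma n (1ℚ - (t + t)) (normSq a) (sum a * sum a) ⟩
      (1ℚ - (t + t)) * (n * normSq a) + S
        ≡⟨ cong (λ x → (1ℚ - (t + t)) * x + S) (*-distribˡ-sum n (λ v → a v * a v)) ⟩
      (1ℚ - (t + t)) * meanNormSq f + S ∎
      where
      lemma : ∀ n q x y → n * (q * x + y) ≡ q * (n * x) + n * y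
      lemma = solve 4 (λ n q x y → n :* (q :* x :+ y) := q :* (n :* x) :+ n :* y) refl
    -- Taking cloud means does not increase the norm, A preserves it as a permutation of
    -- coordinates, and B does not increase it.
    h₆ : ∑[ v < N ] (n * (mean (h v) * mean (h v))) ≤ totalDeviation f
    h₆ = begin
      meanNormSq h                      ≤⟨ meanNormSq≤normSq₂ h ⟩
      normSq₂ h                         ≡⟨ normSq₂-cross G (λ w → walk C (g w)) ⟩
      normSq₂ (λ w → walk C (g w))      ≤⟨ sum-mono-≤ (λ w → normSq-walk≤ C (g w)) ⟩
      normSq₂ g                         ≡⟨ sum-cong-≗ (λ w → deviation≡ (f w)) ⟩
      totalDeviation f                  ∎

-- From real to rational vectors, term by term

module RealVectors where

  open import Data.Rational using (_*_)
  open FiniteSums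
  open OddCycle
  open ZigZagEstimate

  seq-Σᴿ : ∀ {m} (f : Fin m → ℝ) n → seq (Σᴿ f) n ≡ ∑[ i < m ] seq (f i) n
  seq-Σᴿ {zero}  f n = refl
  seq-Σᴿ {suc m} f n = cong (seq (f Fin.zero) n +_) (seq-Σᴿ (f ∘ Fin.suc) n)

  seq-· : ∀ {N} (M : Fin N → Fin N → ℝ) (α : Fin N → ℝ) u n →
          seq ((M · α) u) n ≡ ∑[ v < N ] seq (M u v *ᴿ α v) n
  seq-· M α u n = seq-Σᴿ (λ v → M u v *ᴿ α v) n

  indicator : ∀ {N D} → Fin N × Fin D → Fin N → Fin D → ℚ
  indicator e v j = card (if does (e ≟ᴱ (v , j)) then 1 else 0)

  ∑∑-indicator : ∀ {N D} (e : Fin N × Fin D) (x : Fin N → ℚ) →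
                 ∑[ v < N ] ∑[ j < D ] (indicator e v j * x v) ≡ x (proj₁ e)
  ∑∑-indicator {N} {D} e@(w , ℓ) x =
    trans (sum-single (λ v → ∑[ j < D ] (indicator e v j * x v)) w
            (λ v v≢w → sum-zero λ j → vanish v j (v≢w ∘ sym ∘ cong proj₁)))
          (trans (sum-single (λ j → indicator e w j * x w) ℓ
                   (λ j j≢ℓ → vanish w j (j≢ℓ ∘ sym ∘ cong proj₂)))
                 diagonal)
    where
    vanish : ∀ v j → e ≢ (v , j) → indicator e v j * x v ≡ 0ℚ
    vanish v j e≢ with e ≟ᴱ (v , j)
    ... | yes e≡ = contradiction e≡ e≢
    ... | no  _  = *-zeroˡ (x v)
    diagonal : indicator e w ℓ * x w ≡ x w
    diagonal with e ≟ᴱ (w , ℓ)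
    ... | yes _  = trans (cong (_* x w) (+-identityʳ 1ℚ)) (*-identityˡ (x w))
    ... | no  e≢ = contradiction refl e≢

  card-edges : ∀ {N D} (G : Graph N D) u v →
    card (edges G u v) ≡ ∑[ i < D ] ∑[ j < D ] indicator (rot G (u , i)) v j
  card-edges {N} {D} G u v = trans (card-Σᴺ edgesFrom)
    (sum-cong-≗ λ i → card-Σᴺ λ j → if does (rot G (u , i) ≟ᴱ (v , j)) then 1 else 0)
    where
    edgesFrom : Fin D → ℕ
    edgesFrom i = Σᴺ λ j → if does (rot G (u , i) ≟ᴱ (v , j)) then 1 else 0

  -- `edges` counts pairs of labels, and for each `i` exactly one pair `(v , j)` equals
  -- `rot G (u , i)`; exchanging the sums leaves one term per label `i`.
  ∑-edges : ∀ {N D} (G : Graph N D) (x : Fin N → ℚ) u →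
    ∑[ v < N ] (card (edges G u v) * x v) ≡ ∑[ i < D ] x (neighbour G u i)
  ∑-edges {N} {D} G x u = begin
    ∑[ v < N ] (card (edges G u v) * x v)
      ≡⟨ sum-cong-≗ expand ⟩
    ∑[ v < N ] ∑[ i < D ] ∑[ j < D ] (indicator (rot G (u , i)) v j * x v)
      ≡⟨ ∑-comm (λ v i → ∑[ j < D ] (indicator (rot G (u , i)) v j * x v)) ⟩
    ∑[ i < D ] ∑[ v < N ] ∑[ j < D ] (indicator (rot G (u , i)) v j * x v)
      ≡⟨ sum-cong-≗ (λ i → ∑∑-indicator (rot G (u , i)) x) ⟩
    ∑[ i < D ] x (neighbour G u i) ∎
    where
    open ≡-Reasoning
    expand : ∀ v → card (edges G u v) * x v ≡ ∑[ i < D ] ∑[ j < D ] (indicator (rot G (u , i)) v j * x v)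
    expand v = begin
      card (edges G u v) * x v
        ≡⟨ cong (_* x v) (card-edges G u v) ⟩
      (∑[ i < D ] ∑[ j < D ] indicator (rot G (u , i)) v j) * x v
        ≡⟨ *-distribʳ-sum (x v) (λ i → ∑[ j < D ] indicator (rot G (u , i)) v j) ⟩
      ∑[ i < D ] ((∑[ j < D ] indicator (rot G (u , i)) v j) * x v)
        ≡⟨ sum-cong-≗ (λ i → *-distribʳ-sum (x v) (indicator (rot G (u , i)) v)) ⟩
      ∑[ i < D ] ∑[ j < D ] (indicator (rot G (u , i)) v j * x v) ∎

  seq-adjacency-entry : ∀ {N D} .{{nz : NonZero D}} (G : Graph N D) u v (y : ℝ) n →
    seq (adjacency {{nz}} G u v *ᴿ y) n ≡ recip (ℕ.pred D) * (card (edges G u v) * seq y n)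
  seq-adjacency-entry {N} {D} {{nz}} G u v y n = trans
    (cong (_* seq y n) (m/n≡card*recip (edges G u v) D {{nz}}))
    (lemma (card (edges G u v)) (recip (ℕ.pred D)) (seq y n))
    where
    open +-*-Solver
    lemma : ∀ c r x → c * r * x ≡ r * (c * x)
    lemma = solve 3 (λ c r x → c :* r :* x := r :* (c :* x)) refl

  -- The matrix entries are constant sequences, so the n-th terms of the real matrix product are
  -- exactly the rational operator applied to the n-th terms of the vector. No limit is involved,
  -- and bounds for rational vectors carry over index by index.
  seq-adjacency : ∀ {N D} .{{nz : NonZero D}} (G : Graph N D) (α : Fin N → ℝ) u n →
                  seq ((adjacency {{nz}} G · α) u) n ≡ transition G (λ v → seq (α v) n) u
  seq-adjacency {N} {D} {{nz}} G α u n = trans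
    (trans (seq-· (adjacency {{nz}} G) α u n) (sum-cong-≗ λ v → seq-adjacency-entry {{nz}} G u v (α v) n))
    (trans (sym (*-distribˡ-sum (recip (ℕ.pred D)) (λ v → card (edges G u v) * seq (α v) n)))
           (cong (recip (ℕ.pred D) *_) (∑-edges G (λ v → seq (α v) n) u)))

  neighbour-ⓩ : ∀ {N D E} (G : Graph N D) (C : Graph D E) v k i j →
    neighbour (G ⓩ C) (combine v k) (combine i j) ≡
    uncurry (λ w ℓ → combine w (neighbour C ℓ j)) (rot G (v , neighbour C k i))
  neighbour-ⓩ G C v k i j =
    cong₂ (λ vk ij → uncurry combine (proj₁ (zigzagRot G C (vk , ij))))
          (Fin.remQuot-combine v k) (Fin.remQuot-combine i j)

  -- The mean over four labels, with weight `recip 3` equal to a quarter, splits into two means over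
  -- two labels: `i` belongs to the outer walk, taken before the step in G, and `j` to the inner
  -- walk, taken after it.
  transition-ⓩ : ∀ {N D} (G : Graph N D) (C : Graph D 2) (x : Fin (N ℕ.* D) → ℚ) v k →
    transition (G ⓩ C) x (combine v k) ≡ zigzag G C (λ w ℓ → x (combine w ℓ)) v k
  transition-ⓩ G C x v k = trans
    (cong (recip 3 *_) (trans (sum-combine 2 {2} (λ l → x (neighbour (G ⓩ C) (combine v k) l)))
                              (∑∑-cong λ i j → cong x (neighbour-ⓩ G C v k i j))))
    (lemma (y Fin.zero Fin.zero) (y Fin.zero (Fin.suc Fin.zero))
           (y (Fin.suc Fin.zero) Fin.zero) (y (Fin.suc Fin.zero) (Fin.suc Fin.zero)))
    where
    open +-*-Solver
    y : Fin 2 → Fin 2 → ℚ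
    y i j = x (uncurry (λ w ℓ → combine w (neighbour C ℓ j)) (rot G (v , neighbour C k i)))
    lemma : ∀ a b c d → recip 3 * (a + (b + 0ℚ) + (c + (d + 0ℚ) + 0ℚ)) ≡ ½ * (½ * (a + b) + ½ * (c + d))
    lemma = solve 4 (λ a b c d → let o = con 0ℚ in
      con (recip 3) :* (a :+ (b :+ o) :+ (c :+ (d :+ o) :+ o))
      := con ½ :* (con ½ :* (a :+ b) :+ con ½ :* (c :+ d))) refl

  seq-normSq : ∀ {m} (α : Fin m → ℝ) n → seq ⟨ α , α ⟩ n ≡ normSq (λ v → seq (α v) n)
  seq-normSq α n = seq-Σᴿ (λ v → α v *ᴿ α v) n

  seq-⟨,𝟙⟩ : ∀ {m} (α : Fin m → ℝ) n → seq ⟨ α , 𝟙 ⟩ n ≡ ∑[ v < m ] seq (α v) n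
  seq-⟨,𝟙⟩ α n = trans (seq-Σᴿ (λ v → α v *ᴿ 𝟙 v) n) (sum-cong-≗ λ v → *-identityʳ (seq (α v) n))

  seq-normSq-adjacency : ∀ {N D} .{{nz : NonZero D}} (G : Graph N D) (α : Fin N → ℝ) n →
    seq ⟨ adjacency {{nz}} G · α , adjacency {{nz}} G · α ⟩ n ≡ normSq (transition G (λ v → seq (α v) n))
  seq-normSq-adjacency {{nz}} G α n = trans (seq-normSq (adjacency {{nz}} G · α) n)
                                     (normSq-cong λ u → seq-adjacency {{nz}} G α u n)

  -- Passing between approximate square roots and squared norms

  ≤-fromε : ∀ {p q} → (∀ ε → 0ℚ < ε → p ≤ q + ε) → p ≤ q
  ≤-fromε {p} {q} h = ≮⇒≥ λ q<p → <-irrefl refl (p<p (half>0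
    (≤-<-trans (≤-reflexive (sym (+-inverseʳ q))) (+-monoˡ-< (- q) q<p))))
    where
    open ≤-Reasoning
    open +-*-Solver
    lemma : ∀ p q → q + ½ * (p - q) + ½ * (p - q) ≡ p
    lemma = solve 2 (λ p q → q :+ con ½ :* (p :- q) :+ con ½ :* (p :- q) := p) refl
    p<p : 0ℚ < ½ * (p - q) → p < p
    p<p 0<½d = begin-strict
      p                                 ≤⟨ h (½ * (p - q)) 0<½d ⟩
      q + ½ * (p - q)                   ≡⟨ +-identityʳ (q + ½ * (p - q)) ⟨
      q + ½ * (p - q) + 0ℚ              <⟨ +-monoʳ-< (q + ½ * (p - q)) 0<½d ⟩
      q + ½ * (p - q) + ½ * (p - q)     ≡⟨ lemma p q ⟩
      p                                 ∎

  fromℚ≃0⇒≡0 : ∀ p → fromℚ p ≃ 0ᴿ → p ≡ 0ℚ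
  fromℚ≃0⇒≡0 p p≃0 = ∣p∣≡0⇒p≡0 p (≤-antisym (≤-fromε bound) (0≤∣p∣ p))
    where
    bound : ∀ ε → 0ℚ < ε → ∣ p ∣ ≤ 0ℚ + ε
    bound ε 0<ε = let K , h = p≃0 ε 0<ε in
      ≤-trans (≤-reflexive (cong ∣_∣ (sym (+-identityʳ p))))
              (≤-trans (h K ℕ.≤-refl) (≤-reflexive (sym (+-identityˡ ε))))

  -- From 2z ≤ z² + 1 and δ² ≤ δ. The error is linear in δ, so that `rescale` can later make it any
  -- prescribed ε.
  [z+δ]²-bound : ∀ z δ X → 0ℚ ≤ δ → δ ≤ 1ℚ → z * z ≤ X → (z + δ) * (z + δ) ≤ X + (X + (1ℚ + 1ℚ)) * δ
  [z+δ]²-bound z δ X 0≤δ δ≤1 z²≤X = 0≤q-p⇒p≤q (≤-trans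
    (0≤p+q (0≤p+q (0≤p*q (0≤p+q (nonNegative⁻¹ 1ℚ) 0≤δ) (p≤q⇒0≤q-p z²≤X))
                  (0≤p*q 0≤δ (0≤p² (z - 1ℚ))))
           (0≤p*q 0≤δ (p≤q⇒0≤q-p δ≤1)))
    (≤-reflexive (lemma z δ X)))
    where
    open +-*-Solver
    lemma : ∀ z δ X → (1ℚ + δ) * (X - z * z) + δ * ((z - 1ℚ) * (z - 1ℚ)) + δ * (1ℚ - δ)
                      ≡ X + (X + (1ℚ + 1ℚ)) * δ - (z + δ) * (z + δ)
    lemma = solve 3 (λ z δ X → let one = con 1ℚ in
      (one :+ δ) :* (X :- z :* z) :+ δ :* ((z :- one) :* (z :- one)) :+ δ :* (one :- δ)
      := X :+ (X :+ (one :+ one)) :* δ :- (z :+ δ) :* (z :+ δ)) refl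

  -- Squaring the hypothesis gives the factor q², which is weakened to q. One half of δ pays for the
  -- rounding of `approx√ P n`, the other is the error already present in the hypothesis.
  approx√-bound⇒≤+ε : ∀ P Q q δ n → 0ℚ ≤ Q → 0ℚ ≤ q → q ≤ 1ℚ → 0ℚ ≤ δ → δ ≤ 1ℚ →
    recip n ≤ ½ * δ → approx√ P n ≤ q * approx√ Q n + ½ * δ →
    P ≤ q * Q + (q * Q + (1ℚ + 1ℚ)) * δ
  approx√-bound⇒≤+ε P Q q δ n 0≤Q 0≤q q≤1 0≤δ δ≤1 r≤ s≤ = begin
    P                                     ≤⟨ p≤∣p∣ P ⟩
    ∣ P ∣                                 ≤⟨ <⇒≤ (approx√-upper P n) ⟩
    (s + r) * (s + r)                     ≤⟨ *-mono-≤-nonNeg 0≤s+r (≤-trans 0≤s+r s+r≤) s+r≤ s+r≤ ⟩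
    (q * w + δ) * (q * w + δ)             ≤⟨ [z+δ]²-bound (q * w) δ (q * Q) 0≤δ δ≤1 z²≤qQ ⟩
    q * Q + (q * Q + (1ℚ + 1ℚ)) * δ       ∎
    where
    open ≤-Reasoning
    open +-*-Solver using (solve; _:+_; _:*_; _:-_; _:=_)
    r = recip n
    s = approx√ P n
    w = approx√ Q n
    0≤s+r : 0ℚ ≤ s + r
    0≤s+r = 0≤p+q (approx√≥0 P n) (recip-nonNeg n)
    s+r≤ : s + r ≤ q * w + δ
    s+r≤ = ≤-trans (+-mono-≤ s≤ r≤) (≤-reflexive (trans (+-assoc (q * w) (½ * δ) (½ * δ))
                                                        (cong (q * w +_) (half+half δ))))
    lemma : ∀ q w → q * w * (q * w) ≡ q * q * (w * w)
    lemma = solve 2 (λ q w → q :* w :* (q :* w) := q :* q :* (w :* w)) refl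
    q²≤q : q * q ≤ q
    q²≤q = ≤-trans (*-monoˡ-≤-nonNeg q {{ℚ.nonNegative 0≤q}} q≤1) (≤-reflexive (*-identityʳ q))
    z²≤qQ : q * w * (q * w) ≤ q * Q
    z²≤qQ = begin
      q * w * (q * w)     ≡⟨ lemma q w ⟩
      q * q * (w * w)     ≤⟨ *-mono-≤-nonNeg (0≤p² w) 0≤q q²≤q (approx√-lower Q n) ⟩
      q * ∣ Q ∣           ≡⟨ cong (q *_) (0≤p⇒∣p∣≡p 0≤Q) ⟩
      q * Q               ∎

  0<p⊓1 : ∀ {p} → 0ℚ < p → 0ℚ < p ⊓ 1ℚ
  0<p⊓1 {p} 0<p with ⊓-sel p 1ℚ
  ... | inj₁ e = <-≤-trans 0<p (≤-reflexive (sym e))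
  ... | inj₂ e = <-≤-trans (positive⁻¹ 1ℚ) (≤-reflexive (sym e))

  -- P and Q are fixed while the index n varies, so the errors can be made arbitrarily small and
  -- vanish from the conclusion. Capping δ at 1 provides the bound under which δ² ≤ δ.
  approx√-bound⇒≤ : ∀ P Q q → 0ℚ ≤ Q → 0ℚ ≤ q → q ≤ 1ℚ →
    (∀ ε → 0ℚ < ε → ∃ λ n → recip n ≤ ε × approx√ P n ≤ q * approx√ Q n + ε) → P ≤ q * Q
  approx√-bound⇒≤ P Q q 0≤Q 0≤q q≤1 h = ≤-fromε λ ε 0<ε →
    choose ε (rescale (q * Q + (1ℚ + 1ℚ)) ε 0<qQ+2 0<ε)
    where
    0<qQ+2 : 0ℚ < q * Q + (1ℚ + 1ℚ)
    0<qQ+2 = +-mono-≤-< (0≤p*q 0≤q 0≤Q) (positive⁻¹ (1ℚ + 1ℚ))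
    apply : ∀ δ → 0ℚ < δ → δ ≤ 1ℚ → (∃ λ n → recip n ≤ ½ * δ × approx√ P n ≤ q * approx√ Q n + ½ * δ) →
            P ≤ q * Q + (q * Q + (1ℚ + 1ℚ)) * δ
    apply δ 0<δ δ≤1 (n , r≤ , s≤) = approx√-bound⇒≤+ε P Q q δ n 0≤Q 0≤q q≤1 (<⇒≤ 0<δ) δ≤1 r≤ s≤
    choose : ∀ ε → (∃ λ δ → 0ℚ < δ × (q * Q + (1ℚ + 1ℚ)) * δ ≡ ε) → P ≤ q * Q + ε
    choose ε (δ , 0<δ , eq) = ≤-trans
      (apply (δ ⊓ 1ℚ) (0<p⊓1 0<δ) (p⊓q≤q δ 1ℚ) (h (½ * (δ ⊓ 1ℚ)) (half>0 (0<p⊓1 0<δ))))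
      (+-monoʳ-≤ (q * Q) (≤-trans
        (*-monoˡ-≤-nonNeg (q * Q + (1ℚ + 1ℚ)) {{ℚ.nonNegative (<⇒≤ 0<qQ+2)}} (p⊓q≤p δ 1ℚ))
        (≤-reflexive eq)))

  -- A rational vector becomes a real one with constant coordinates, whose orthogonality to `𝟙` is
  -- exact; the eigenvalue bound is then read at one large index for each ε.
  secondEigenvalue⇒contracts : ∀ {N D} .{{nz : NonZero D}} (G : Graph N D) μ q → 0ℚ ≤ q → q ≤ 1ℚ →
    (∃ λ K → ∀ n → K ℕ.≤ n → seq μ n ≤ q) → SecondEigenvalue≤ {{nz}} G μ → Contracts G q
  secondEigenvalue⇒contracts {N} {D} {{nz}} G μ q 0≤q q≤1 (K₁ , μ≤q) (_ , λ≤μ) a sum≡0 =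
    -- The eigenvalue bound speaks of nonzero vectors only. Whether a rational vector is zero is
    -- decidable, and the zero vector is treated directly.
    decide (Fin.all? λ v → a v ℚ.≟ 0ℚ)
    where
    open ≤-Reasoning
    α : Fin N → ℝ
    α v = fromℚ (a v)
    orthogonal : ⟨ α , 𝟙 ⟩ ≃ 0ᴿ
    orthogonal ε 0<ε = 0 , λ n _ →
      ≤-trans (≤-reflexive (cong (λ x → ∣ x - 0ℚ ∣) (trans (seq-⟨,𝟙⟩ α n) sum≡0))) (<⇒≤ 0<ε)
    normSq≡0 : (∀ v → a v ≡ 0ℚ) → normSq (transition G a) ≡ 0ℚ
    normSq≡0 a≡0 = sum-zero λ u → trans
      (cong (λ x → x * x) (trans (cong (recip (ℕ.pred D) *_) (sum-zero λ i → a≡0 (neighbour G u i)))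
                                 (*-zeroʳ (recip (ℕ.pred D)))))
      (*-zeroˡ 0ℚ)
    bound : ∀ n ε → K₁ ℕ.≤ n →
            approx√ (seq ⟨ adjacency {{nz}} G · α , adjacency {{nz}} G · α ⟩ n) n
              ≤ seq μ n * approx√ (seq ⟨ α , α ⟩ n) n + ε →
            approx√ (normSq (transition G a)) n ≤ q * approx√ (normSq a) n + ε
    bound n ε K₁≤n h = begin
      approx√ (normSq (transition G a)) n
        ≡⟨ cong (λ x → approx√ x n) (seq-normSq-adjacency {{nz}} G α n) ⟨
      approx√ (seq ⟨ adjacency {{nz}} G · α , adjacency {{nz}} G · α ⟩ n) n
        ≤⟨ h ⟩
      seq μ n * approx√ (seq ⟨ α , α ⟩ n) n + ε
        ≡⟨ cong (λ x → seq μ n * approx√ x n + ε) (seq-normSq α n) ⟩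
      seq μ n * approx√ (normSq a) n + ε
        ≤⟨ +-monoˡ-≤ ε (*-monoʳ-≤-nonNeg (approx√ (normSq a) n)
             {{ℚ.nonNegative (approx√≥0 (normSq a) n)}} (μ≤q n K₁≤n)) ⟩
      q * approx√ (normSq a) n + ε ∎
    close : ¬ (∀ v → a v ≡ 0ℚ) → ∀ ε → 0ℚ < ε →
            ∃ λ n → recip n ≤ ε × approx√ (normSq (transition G a)) n ≤ q * approx√ (normSq a) n + ε
    close a≢0 ε 0<ε =
      let K₂ , h = λ≤μ α orthogonal (λ α≃0 → a≢0 λ v → fromℚ≃0⇒≡0 (a v) (α≃0 v)) ε 0<ε
          K₃ , r = recip-small ε 0<ε
          K₂₃ = K₂ ℕ.⊔ K₃
          n = K₁ ℕ.⊔ K₂₃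
      in n , r n (ℕ.m⊔n≤o⇒n≤o K₂ K₃ (ℕ.m≤n⊔m K₁ K₂₃))
           , bound n ε (ℕ.m≤m⊔n K₁ K₂₃) (h n (ℕ.m⊔n≤o⇒m≤o K₂ K₃ (ℕ.m≤n⊔m K₁ K₂₃)))
    decide : Dec (∀ v → a v ≡ 0ℚ) → normSq (transition G a) ≤ q * normSq a
    decide (yes a≡0) = ≤-trans (≤-reflexive (normSq≡0 a≡0)) (0≤p*q 0≤q (normSq-nonNeg a))
    decide (no a≢0)  =
      approx√-bound⇒≤ (normSq (transition G a)) (normSq a) q (normSq-nonNeg a) 0≤q q≤1 (close a≢0)

  -- The root of p² Q + s² is at most p times the root of Q, plus the absolute value of s. One half
  -- of ε covers s and the other the rounding of `approx√ Q n`; squares are compared, since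
  -- `approx√` is known only through bounds on its square.
  approx√-contraction : ∀ P Q s p ε n → 0ℚ ≤ P → 0ℚ ≤ Q → 0ℚ ≤ p → p ≤ 1ℚ → 0ℚ ≤ ε →
    P ≤ p * p * Q + s * s → ∣ s ∣ ≤ ½ * ε → recip n ≤ ½ * ε →
    approx√ P n ≤ p * approx√ Q n + ε
  approx√-contraction P Q s p ε n 0≤P 0≤Q 0≤p p≤1 0≤ε P≤ s≤ r≤ = p²≤q²⇒p≤q 0≤pw+ε (begin
    approx√ P n * approx√ P n             ≤⟨ approx√-lower P n ⟩
    ∣ P ∣                                 ≡⟨ 0≤p⇒∣p∣≡p 0≤P ⟩
    P                                     ≤⟨ P≤ ⟩
    p * p * Q + s * s                     ≤⟨ +-mono-≤ p²Q≤ s²≤ ⟩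
    p * (w + r) * (p * (w + r)) + e * e   ≤⟨ 0≤q-p⇒p≤q (≤-trans (0≤p*q (0≤p+q 0≤p[w+r] 0≤p[w+r]) 0≤e)
                                                (≤-reflexive (lemma₂ (p * (w + r)) e))) ⟩
    (p * (w + r) + e) * (p * (w + r) + e) ≤⟨ *-mono-≤-nonNeg (0≤p+q 0≤p[w+r] 0≤e) 0≤pw+ε step step ⟩
    (p * w + ε) * (p * w + ε)             ∎)
    where
    open ≤-Reasoning
    open +-*-Solver
    w = approx√ Q n
    r = recip n
    e = ½ * ε
    0≤e : 0ℚ ≤ e
    0≤e = 0≤p*q (nonNegative⁻¹ ½) 0≤ε
    0≤p[w+r] : 0ℚ ≤ p * (w + r)
    0≤p[w+r] = 0≤p*q 0≤p (0≤p+q (approx√≥0 Q n) (recip-nonNeg n))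
    0≤pw+ε : 0ℚ ≤ p * w + ε
    0≤pw+ε = 0≤p+q (0≤p*q 0≤p (approx√≥0 Q n)) 0≤ε
    lemma₁ : ∀ p x → p * p * (x * x) ≡ p * x * (p * x)
    lemma₁ = solve 2 (λ p x → p :* p :* (x :* x) := p :* x :* (p :* x)) refl
    lemma₂ : ∀ x e → (x + x) * e ≡ (x + e) * (x + e) - (x * x + e * e)
    lemma₂ = solve 2 (λ x e → (x :+ x) :* e := (x :+ e) :* (x :+ e) :- (x :* x :+ e :* e)) refl
    lemma₃ : ∀ p w r → p * (w + r) ≡ p * w + p * r
    lemma₃ = solve 3 (λ p w r → p :* (w :+ r) := p :* w :+ p :* r) refl
    p²Q≤ : p * p * Q ≤ p * (w + r) * (p * (w + r))
    p²Q≤ = ≤-trans (*-monoˡ-≤-nonNeg (p * p) {{ℚ.nonNegative (0≤p² p)}}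
                     (≤-trans (p≤∣p∣ Q) (<⇒≤ (approx√-upper Q n))))
                   (≤-reflexive (lemma₁ p (w + r)))
    s²≤ : s * s ≤ e * e
    s²≤ = ≤-trans (p≤∣p∣ (s * s)) (≤-trans (≤-reflexive (∣p*q∣≡∣p∣*∣q∣ s s))
                                           (*-mono-≤-nonNeg (0≤∣p∣ s) 0≤e s≤ s≤))
    step : p * (w + r) + e ≤ p * w + ε
    step = begin
      p * (w + r) + e         ≡⟨ cong (_+ e) (lemma₃ p w r) ⟩
      p * w + p * r + e
        ≤⟨ +-monoˡ-≤ e (+-monoʳ-≤ (p * w) (≤-trans
             (*-mono-≤-nonNeg {p} {1ℚ} {r} {e} (recip-nonNeg n) (nonNegative⁻¹ 1ℚ) p≤1 r≤)
                                                   (≤-reflexive (*-identityˡ e)))) ⟩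
      p * w + e + e           ≡⟨ +-assoc (p * w) e e ⟩
      p * w + (e + e)         ≡⟨ cong (p * w +_) (half+half ε) ⟩
      p * w + ε               ∎

  -- For a real vector orthogonal to `𝟙`, the sums of its n-th terms tend to 0 without having to
  -- vanish; the term `sum x * sum x` in the hypothesis absorbs them.
  contraction⇒secondEigenvalue : ∀ {N D} .{{nz : NonZero D}} (G : Graph N D) p → 0ℚ ≤ p → p ≤ 1ℚ →
    (∀ x → normSq (transition G x) ≤ p * p * normSq x + sum x * sum x) → SecondEigenvalue≤ {{nz}} G (fromℚ p)
  contraction⇒secondEigenvalue {N} {{nz}} G p 0≤p p≤1 bound =
    (λ _ ε 0<ε → 0 , λ _ _ → 0≤p+q 0≤p (<⇒≤ 0<ε)) , λ α α⊥𝟙 _ ε 0<ε →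
      let K₁ , h = α⊥𝟙 (½ * ε) (half>0 0<ε)
          K₂ , r = recip-small (½ * ε) (half>0 0<ε)
      in K₁ ℕ.⊔ K₂ , λ n K≤n →
        main α ε n (<⇒≤ 0<ε) (h n (ℕ.m⊔n≤o⇒m≤o K₁ K₂ K≤n)) (r n (ℕ.m⊔n≤o⇒n≤o K₁ K₂ K≤n))
    where
    open ≤-Reasoning
    main : ∀ (α : Fin N → ℝ) ε n → 0ℚ ≤ ε → ∣ seq ⟨ α , 𝟙 ⟩ n - 0ℚ ∣ ≤ ½ * ε → recip n ≤ ½ * ε →
           approx√ (seq ⟨ adjacency {{nz}} G · α , adjacency {{nz}} G · α ⟩ n) n ≤ p * approx√ (seq ⟨ α , α ⟩ n) n + ε
    main α ε n 0≤ε h r = begin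
      approx√ (seq ⟨ adjacency {{nz}} G · α , adjacency {{nz}} G · α ⟩ n) n
        ≡⟨ cong (λ y → approx√ y n) (seq-normSq-adjacency {{nz}} G α n) ⟩
      approx√ (normSq (transition G x)) n
        ≤⟨ approx√-contraction (normSq (transition G x)) (normSq x) (sum x) p ε n
             (normSq-nonNeg (transition G x)) (normSq-nonNeg x) 0≤p p≤1 0≤ε (bound x)
             (≤-trans (≤-reflexive (cong ∣_∣ (trans (sym (seq-⟨,𝟙⟩ α n)) (sym (+-identityʳ _))))) h) r ⟩
      p * approx√ (normSq x) n + ε
        ≡⟨ cong (λ y → p * approx√ y n + ε) (seq-normSq α n) ⟨
      p * approx√ (seq ⟨ α , α ⟩ n) n + ε ∎
      where
      x : Fin N → ℚ
      x v = seq (α v) n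

-- The eigenvalue bound for the zig-zag product

module ZigZagExpander where

  open import Data.Rational using (_*_)
  open FiniteSums
  open OddCycle
  open ZigZagEstimate
  open RealVectors

  normSq-combine : ∀ {N D} (x : Fin (N ℕ.* D) → ℚ) → normSq x ≡ normSq₂ {N} {D} (λ v k → x (combine v k))
  normSq-combine {N} x = sum-combine N (λ u → x u * x u)

  normSq-transition-ⓩ : ∀ {N d} (G : Graph N (suc d)) (C : Graph (suc d) 2) t η →
    0ℚ ≤ t → t + t ≤ 1ℚ → 0ℚ ≤ η → η ≤ 1ℚ →
    Contracts G (1ℚ - (t + t)) → (∀ g → normSq (walk C g) ≤ normSq g - η * deviation g) →
    ∀ x → normSq (transition (G ⓩ C) x) ≤ (1ℚ - ¼ * η * t * t) * normSq x + sum x * sum x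
  normSq-transition-ⓩ {N} {d} G C t η 0≤t 2t≤1 0≤η η≤1 contracts gap x = begin
    normSq (transition (G ⓩ C) x)
      ≡⟨ normSq-combine {N} {suc d} (transition (G ⓩ C) x) ⟩
    normSq₂ {N} {suc d} (λ v k → transition (G ⓩ C) x (combine v k))
      ≡⟨ sum-cong-≗ (λ v → normSq-cong (transition-ⓩ G C x v)) ⟩
    normSq₂ (zigzag G C f)
      ≤⟨ zigzag-bound G C t η 0≤t 2t≤1 0≤η η≤1 contracts gap f ⟩
    (1ℚ - ¼ * η * t * t) * normSq₂ f + (∑[ v < N ] sum (f v)) * (∑[ v < N ] sum (f v))
      ≡⟨ cong₂ (λ n s → (1ℚ - ¼ * η * t * t) * n + s * s) (normSq-combine {N} {suc d} x) (sum-combine N {suc d} x) ⟨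
    (1ℚ - ¼ * η * t * t) * normSq x + sum x * sum x ∎
    where
    open ≤-Reasoning
    f : Fin N → Fin (suc d) → ℚ
    f v k = x (combine v k)

  -- The slack is the square of ρ/2. The bound replaces the square root of the contraction factor by
  -- a rational number.
  square-root-bound : ∀ ρ → 1ℚ - ρ ≤ (1ℚ - ½ * ρ) * (1ℚ - ½ * ρ)
  square-root-bound ρ = 0≤q-p⇒p≤q (≤-trans (0≤p² (½ * ρ)) (≤-reflexive (lemma ρ)))
    where
    open +-*-Solver
    lemma : ∀ ρ → ½ * ρ * (½ * ρ) ≡ (1ℚ - ½ * ρ) * (1ℚ - ½ * ρ) - (1ℚ - ρ)
    lemma = solve 1 (λ ρ → con ½ :* ρ :* (con ½ :* ρ)
              := (con 1ℚ :- con ½ :* ρ) :* (con 1ℚ :- con ½ :* ρ) :- (con 1ℚ :- ρ)) refl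

  0<p*q : ∀ {p q} → 0ℚ < p → 0ℚ < q → 0ℚ < p * q
  0<p*q {p} {q} 0<p 0<q = positive⁻¹ (p * q) {{pos*pos⇒pos p {{ℚ.positive 0<p}} q {{ℚ.positive 0<q}}}}

  -- The λ′ of the theorem, 1 - ηt²/8, whose square is at least 1 - ηt²/4.
  rate : ℚ → ℚ → ℚ
  rate t η = 1ℚ - ½ * (¼ * η * t * t)

  0≤¼ηtt : ∀ t η → 0ℚ ≤ t → 0ℚ ≤ η → 0ℚ ≤ ¼ * η * t * t
  0≤¼ηtt t η 0≤t 0≤η = 0≤p*q (0≤p*q (0≤p*q (nonNegative⁻¹ ¼) 0≤η) 0≤t) 0≤t

  ¼ηtt≤1 : ∀ t η → 0ℚ ≤ t → t ≤ 1ℚ → 0ℚ ≤ η → η ≤ 1ℚ → ¼ * η * t * t ≤ 1ℚ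
  ¼ηtt≤1 t η 0≤t t≤1 0≤η η≤1 =
    *-mono-≤-nonNeg {q = 1ℚ} {s = 1ℚ} 0≤t 0≤1 (*-mono-≤-nonNeg {q = 1ℚ} {s = 1ℚ} 0≤t 0≤1
      (*-mono-≤-nonNeg {q = 1ℚ} {s = 1ℚ} 0≤η 0≤1 (from-yes (¼ ≤? 1ℚ)) η≤1) t≤1) t≤1
    where
    0≤1 : 0ℚ ≤ 1ℚ
    0≤1 = nonNegative⁻¹ 1ℚ

  0≤rate : ∀ t η → 0ℚ ≤ t → t ≤ 1ℚ → 0ℚ ≤ η → η ≤ 1ℚ → 0ℚ ≤ rate t η
  0≤rate t η 0≤t t≤1 0≤η η≤1 = p≤q⇒0≤q-p
    (*-mono-≤-nonNeg {q = 1ℚ} {s = 1ℚ} (0≤¼ηtt t η 0≤t 0≤η) (nonNegative⁻¹ 1ℚ) (from-yes (½ ≤? 1ℚ))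
      (¼ηtt≤1 t η 0≤t t≤1 0≤η η≤1))

  rate≤1 : ∀ t η → 0ℚ ≤ t → 0ℚ ≤ η → rate t η ≤ 1ℚ
  rate≤1 t η 0≤t 0≤η =
    ≤-trans (+-monoʳ-≤ 1ℚ (neg-antimono-≤ (0≤p*q (nonNegative⁻¹ ½) (0≤¼ηtt t η 0≤t 0≤η))))
            (≤-reflexive (+-identityʳ 1ℚ))

  normSq-transition-ⓩ≤rate² : ∀ {N d} (G : Graph N (suc d)) (C : Graph (suc d) 2) t η →
    0ℚ ≤ t → t + t ≤ 1ℚ → 0ℚ ≤ η → η ≤ 1ℚ →
    Contracts G (1ℚ - (t + t)) → (∀ g → normSq (walk C g) ≤ normSq g - η * deviation g) →
    ∀ x → normSq (transition (G ⓩ C) x) ≤ rate t η * rate t η * normSq x + sum x * sum x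
  normSq-transition-ⓩ≤rate² G C t η 0≤t 2t≤1 0≤η η≤1 contracts gap x = ≤-trans
    (normSq-transition-ⓩ G C t η 0≤t 2t≤1 0≤η η≤1 contracts gap x)
    (+-monoˡ-≤ (sum x * sum x)
      (*-monoʳ-≤-nonNeg (normSq x) {{ℚ.nonNegative (normSq-nonNeg x)}} (square-root-bound (¼ * η * t * t))))

  zigzag-secondEigenvalue : ∀ {N d} (G : Graph N (suc d)) (C : Graph (suc d) 2)
    .{{nz : NonZero 4}} t η →
    0ℚ ≤ t → t + t ≤ 1ℚ → 0ℚ ≤ η → η ≤ 1ℚ →
    Contracts G (1ℚ - (t + t)) → (∀ g → normSq (walk C g) ≤ normSq g - η * deviation g) →
    SecondEigenvalue≤ {D = 4} {{nz}} (G ⓩ C) (fromℚ (rate t η))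
  zigzag-secondEigenvalue G C {{nz}} t η 0≤t 2t≤1 0≤η η≤1 contracts gap =
    contraction⇒secondEigenvalue {D = 4} {{nz}} (G ⓩ C) (rate t η)
      (0≤rate t η 0≤t t≤1 0≤η η≤1) (rate≤1 t η 0≤t 0≤η)
      (normSq-transition-ⓩ≤rate² G C t η 0≤t 2t≤1 0≤η η≤1 contracts gap)
    where
    t≤1 : t ≤ 1ℚ
    t≤1 = ≤-trans (≤-reflexive (sym (+-identityʳ t))) (≤-trans (+-monoʳ-≤ t 0≤t) 2t≤1)

  fromℚ-rate<1 : ∀ t η → 0ℚ < t → 0ℚ < η → fromℚ (rate t η) <ᴿ 1ᴿ
  fromℚ-rate<1 t η 0<t 0<η =
    ½ * ρ , half>0 (0<p*q (0<p*q (0<p*q (positive⁻¹ ¼) 0<η) 0<t) 0<t) , 0 , λ _ _ → ≤-reflexive (lemma (½ * ρ))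
    where
    open +-*-Solver
    ρ = ¼ * η * t * t
    lemma : ∀ x → 1ℚ - x + x ≡ 1ℚ
    lemma = solve 1 (λ x → con 1ℚ :- x :+ x := con 1ℚ) refl

  <1⇒gap : ∀ μ → μ <ᴿ 1ᴿ → ∃ λ t → 0ℚ < t × t + t ≤ 1ℚ ×
           (∃ λ K → ∀ n → K ℕ.≤ n → seq μ n ≤ 1ℚ - (t + t))
  <1⇒gap μ (ε , 0<ε , K , h) =
    t , half>0 (0<p⊓1 0<ε) , ≤-trans (≤-reflexive 2t≡) (p⊓q≤q ε 1ℚ) , K , λ n K≤n → begin
      seq μ n                 ≡⟨ lemma (seq μ n) ε ⟩
      seq μ n + ε - ε         ≤⟨ +-mono-≤ (h n K≤n) (neg-antimono-≤ (≤-trans (≤-reflexive 2t≡) (p⊓q≤p ε 1ℚ))) ⟩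
      1ℚ - (t + t)            ∎
    where
    open ≤-Reasoning
    open +-*-Solver
    -- Here ε is a margin by which μ stays below 1. The cap at 1 makes 1 - 2t nonnegative even if μ
    -- is very negative.
    t = ½ * (ε ⊓ 1ℚ)
    2t≡ : t + t ≡ ε ⊓ 1ℚ
    2t≡ = half+half (ε ⊓ 1ℚ)
    lemma : ∀ x e → x ≡ x + e - e
    lemma = solve 2 (λ x e → x := x :+ e :- e) refl

  zigzag-expander : ∀ {N d} (G : Graph N (suc d)) (C : Graph (suc d) 2)
    .{{nz : NonZero (suc d)}} .{{nz′ : NonZero 4}} μ t η →
    0ℚ < t → t + t ≤ 1ℚ → 0ℚ < η → η ≤ 1ℚ →
    (∃ λ K → ∀ n → K ℕ.≤ n → seq μ n ≤ 1ℚ - (t + t)) →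
    (∀ g → normSq (walk C g) ≤ normSq g - η * deviation g) →
    SecondEigenvalue≤ {{nz}} G μ → SecondEigenvalue≤ {D = 4} {{nz′}} (G ⓩ C) (fromℚ (rate t η))
  zigzag-expander G C {{nz}} {{nz′}} μ t η 0<t 2t≤1 0<η η≤1 μ≤1-2t gap isExpander =
    zigzag-secondEigenvalue G C {{nz′}} t η (<⇒≤ 0<t) 2t≤1 (<⇒≤ 0<η) η≤1
      (secondEigenvalue⇒contracts {{nz}} G μ (1ℚ - (t + t)) (p≤q⇒0≤q-p 2t≤1) 1-2t≤1 μ≤1-2t isExpander)
      gap
    where
    1-2t≤1 : 1ℚ - (t + t) ≤ 1ℚ
    1-2t≤1 = ≤-trans (+-monoʳ-≤ 1ℚ (neg-antimono-≤ (<⇒≤ (+-mono-< 0<t 0<t)))) (≤-reflexive (+-identityʳ 1ℚ))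

open ZigZagExpander
open OddCycle using (cycle-gap)
open import Data.Nat using (_*_)

corollary3p4 : ∀ (μ : ℝ) → μ <ᴿ 1ᴿ → ∀ (D : ℕ) .{{_ : NonZero D}} → D % 2 ≡ 1 →
    ∃[ μ′ ] μ′ <ᴿ 1ᴿ ×
    (∀ (N : ℕ) .{{_ : NonZero N}} (G : Graph N D) (C : Graph D 2) →
    Is[ N , D , μ ]-graph G → IsCycle C →
    Is[ N * D , 4 , μ′ ]-graph (G ⓩ C))
corollary3p4 μ μ<1 (suc d) {{nz}} odd =
  -- `t` depends on μ alone and `η` on D alone, and both are fixed before N, G and C are given; this
  -- is the uniformity of λ′.
  let t , 0<t , 2t≤1 , μ≤1-2t = <1⇒gap μ μ<1
      η , 0<η , η≤1 , gap = cycle-gap d odd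
  in fromℚ (rate t η) , fromℚ-rate<1 t η 0<t 0<η , λ N G C isExpander isCycle →
    zigzag-expander G C {{nz}} μ t η 0<t 2t≤1 0<η η≤1 μ≤1-2t (gap C isCycle) isExpander
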